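{- Let $k\ge 3$ and let $\mathbf F$ be a $k$-CNF formula on $n$ variables. There exists a randomized algorithm running in time $O^*\left(2^{(1-1/k)n}\right)$ that takes $\mathbf F$ as input and, if $\mathbf F$ is satisfiable, outputs $z_1^*,z_2^*\in\Omega_{\mathbf F}$ with $$d_H(z_1^*,z_2^*)\ \ge\ \frac12\left(1-\frac1k\right)\mathrm{Diam}(\mathbf F)$$ with probability $1-o(1)$.
   Context: $\Omega_{\mathbf F}\subseteq\{0,1\}^n$ is the set of satisfying assignments of $\mathbf F$; $d_H$ is Hamming distance; $\mathrm{Diam}(\mathbf F)=\max_{z_1,z_2\in\Omega_{\mathbf F}} d_H(z_1,z_2)$ for satisfiable $\mathbf F$. A $k$-CNF formula is a conjunction of clauses, each a disjunction of at most $k$ literals; formulas have $n^{O(1)}$ clauses. $k$ is a constant and $O^*$ hides factors polynomial in $n$; $o(1)$ is as $n\to\infty$. -}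

module Defs where

open import Data.Bool using (Bool; true; false; if_then_else_; _xor_; T?)
import Data.Bool as Bool
open import Data.Fin using (Fin; zero; toℕ)
open import Data.Integer using (+_)
open import Data.List using (List; []; _∷_; _++_; map; foldr; filter; length; cartesianProductWith)
open import Data.List.Extrema.Nat using (max)
open import Data.List.Relation.Unary.All using (All; all?)
open import Data.List.Relation.Unary.Any using (Any; any?)
open import Data.Nat using (ℕ; zero; suc; _+_; _*_; _∸_; _^_; _≤_; NonZero)
open import Data.Nat.Properties using (m^n≢0)
open import Data.Product using (Σ-syntax; ∃-syntax; _×_; _,_; proj₁; proj₂)
open import Data.Rational using (ℚ; 1ℚ; ½)
import Data.Rational as ℚ
import Data.Rational.Properties as ℚ
open import Data.Vec using (Vec; []; _∷_; lookup; replicate; zipWith; count; _[_]≔_)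
open import Relation.Binary.PropositionalEquality using (_≡_)
open import Relation.Nullary using (Dec)
open import Relation.Nullary.Decidable using (_×-dec_)
open import Relation.Unary using (Decidable)

Assignment : ℕ → Set
Assignment n = Vec Bool n

-- (i , true) is the literal xᵢ, (i , false) is its negation.
Literal : ℕ → Set
Literal n = Fin n × Bool

Clause : ℕ → Set
Clause n = List (Literal n)

CNF : ℕ → Set
CNF n = List (Clause n)

IsKCNF : ∀ {n} → ℕ → CNF n → Set
IsKCNF k F = All (λ C → length C ≤ k) F

_⊨ˡ_ : ∀ {n} → Assignment n → Literal n → Set
z ⊨ˡ (i , b) = lookup z i ≡ b

_⊨_ : ∀ {n} → Assignment n → CNF n → Set
z ⊨ F = All (Any (z ⊨ˡ_)) F

_⊨?_ : ∀ {n} (z : Assignment n) (F : CNF n) → Dec (z ⊨ F)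
z ⊨? F = all? (any? (λ (i , b) → lookup z i Bool.≟ b)) F

Satisfiable : ∀ {n} → CNF n → Set
Satisfiable F = ∃[ z ] z ⊨ F

d-H : ∀ {n} → Assignment n → Assignment n → ℕ
d-H x y = count T? (zipWith _xor_ x y)

-- All of {0,1}ⁿ, each vector exactly once.
cube : ∀ n → List (Vec Bool n)
cube zero    = [] ∷ []
cube (suc n) = map (false ∷_) (cube n) ++ map (true ∷_) (cube n)

Ω : ∀ {n} → CNF n → List (Assignment n)
Ω {n} F = filter (_⊨? F) (cube n)

-- Equal to 0 (by convention) when F is unsatisfiable.
Diam : ∀ {n} → CNF n → ℕ
Diam F = max 0 (cartesianProductWith d-H (Ω F) (Ω F))

-- The machine model is Jones's WHILE language over binary trees, extended
-- with a fair coin.  Trees are built by sharing (cons allocates one cell)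
-- and are inspected only by hd, tl and a test for nil, so that t steps can
-- be simulated by a random-access machine, and conversely, with an overhead
-- polynomial in log t, which O* absorbs.

infixr 5 _∙_

data Tree : Set where
  nil : Tree
  _∙_ : Tree → Tree → Tree

hdᵗ tlᵗ : Tree → Tree
hdᵗ nil     = nil
hdᵗ (s ∙ t) = s
tlᵗ nil     = nil
tlᵗ (s ∙ t) = t

isCons : Tree → Bool
isCons nil     = false
isCons (_ ∙ _) = true

fromBool : Bool → Tree
fromBool false = nil
fromBool true  = nil ∙ nil

data Expr (v : ℕ) : Set where
  var   : Fin v → Expr v
  nil   : Expr v
  cons  : Expr v → Expr v → Expr v
  hd tl : Expr v → Expr v

infix 4 _≔_

data Stmt (v : ℕ) : Set where
  _≔_   : Fin v → Expr v → Stmt v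
  flip  : Fin v → Stmt v
  cond  : Expr v → List (Stmt v) → List (Stmt v) → Stmt v
  while : Expr v → List (Stmt v) → Stmt v

Store : ℕ → Set
Store v = Vec Tree v

eval : ∀ {v} → Expr v → Store v → Tree
eval (var x)    σ = lookup σ x
eval nil        σ = nil
eval (cons e f) σ = eval e σ ∙ eval f σ
eval (hd e)     σ = hdᵗ (eval e σ)
eval (tl e)     σ = tlᵗ (eval e σ)

-- The statements still to be executed, and the current store.
Config : ℕ → Set
Config v = List (Stmt v) × Store v

-- Every step is offered a random bit, which only flip uses.  A step evaluates
-- at most one expression of the program text, hence performs a number of
-- elementary operations bounded by a constant depending only on the program.
step : ∀ {v} → Bool → Config v → Config v
step b ([]              , σ) = [] , σ
step b ((x ≔ e)     ∷ K , σ) = K , σ [ x ]≔ eval e σ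
step b (flip x      ∷ K , σ) = K , σ [ x ]≔ fromBool b
step b (cond e p q  ∷ K , σ) = (if isCons (eval e σ) then p else q) ++ K , σ
step b (while e p   ∷ K , σ) = (if isCons (eval e σ) then p ++ while e p ∷ K else K) , σ

run : ∀ {v t} → Vec Bool t → Config v → Config v
run []      c = c
run (b ∷ ω) c = run ω (step b c)

-- Variable zero holds the input at the start and the output at the end.
Program : Set
Program = Σ[ v ∈ ℕ ] List (Stmt (suc v))

start : (P : Program) → Tree → Config (suc (proj₁ P))
start (v , p) input = p , input ∷ replicate v nil

HaltsWithin : Program → Tree → ℕ → Set
HaltsWithin P input t = (ω : Vec Bool t) → proj₁ (run ω (start P input)) ≡ []

output : Program → Tree → ∀ {t} → Vec Bool t → Tree
output P input ω = lookup (proj₂ (run ω (start P input))) zero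

-- Probability of an event under the uniform distribution on {0,1}ᵗ.
Pr : ∀ {t} {E : Vec Bool t → Set} → Decidable E → ℚ
Pr {t} E? = ℚ._/_ (+ length (filter E? (cube t))) (2 ^ t) {{m^n≢0 2 t}}

encodeℕ : ℕ → Tree
encodeℕ zero    = nil
encodeℕ (suc n) = nil ∙ encodeℕ n

encodeList : ∀ {A : Set} → (A → Tree) → List A → Tree
encodeList enc = foldr (λ a t → enc a ∙ t) nil

encodeLiteral : ∀ {n} → Literal n → Tree
encodeLiteral (i , b) = encodeℕ (toℕ i) ∙ fromBool b

encode : ∀ {n} → CNF n → Tree
encode {n} F = encodeℕ n ∙ encodeList (encodeList encodeLiteral) F

-- An assignment is output as the list of its bits; missing bits read as false.
decode : ∀ n → Tree → Assignment n
decode zero    t = []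
decode (suc n) t = isCons (hdᵗ t) ∷ decode n (tlᵗ t)

decodePair : ∀ n → Tree → Assignment n × Assignment n
decodePair n t = decode n (hdᵗ t) , decode n (tlᵗ t)

fromℕ : ℕ → ℚ
fromℕ m = + m ℚ./ 1

Dispersed : (k : ℕ) .{{_ : NonZero k}} → ∀ {n} → CNF n → Assignment n × Assignment n → Set
Dispersed k F (z₁ , z₂) =
  z₁ ⊨ F × z₂ ⊨ F ×
  ½ ℚ.* (1ℚ ℚ.- + 1 ℚ./ k) ℚ.* fromℕ (Diam F) ℚ.≤ fromℕ (d-H z₁ z₂)

dispersed? : (k : ℕ) .{{_ : NonZero k}} → ∀ {n} (F : CNF n) → Decidable (Dispersed k F)
dispersed? k F (z₁ , z₂) = (z₁ ⊨? F) ×-dec (z₂ ⊨? F) ×-dec (_ ℚ.≤? _)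

successProbability : (k : ℕ) .{{_ : NonZero k}} → Program → ∀ {n} → CNF n → (t : ℕ) → ℚ
successProbability k P {n} F t =
  Pr {t} (λ ω → dispersed? k F (decodePair n (output P (encode F) ω)))

-- T(n) = O*(2^((1-1/k)n)): there is d with T(n) ≤ (nᵈ + d) · 2^((1-1/k)n) for
-- all n.  Both sides are raised to the k-th power, as 2^((1-1/k)n) need not be
-- rational.
IsO*2^[1-1/_]n : ℕ → (ℕ → ℕ) → Set
IsO*2^[1-1/ k ]n T = ∃[ d ] ∀ n → T n ^ k ≤ (n ^ d + d) ^ k * 2 ^ ((k ∸ 1) * n)

{-# OPTIONS --safe #-}
module Submission where

open import Defs
open import Data.List using (length)
open import Data.Nat using (ℕ; _+_; _^_; _≤_; NonZero)
open import Data.Product using (∃-syntax; _×_)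
open import Data.Rational using (ℚ; 0ℚ; 1ℚ) renaming (_<_ to _<ℚ_; _≤_ to _≤ℚ_; _-_ to _-ℚ_)

open import Data.Bool using (Bool; true; false; if_then_else_; _xor_; not)
open import Data.Bool.Properties using (xor-assoc; xor-same)
open import Data.Empty using (⊥-elim)
open import Data.Fin using (Fin; zero; suc; toℕ)
open import Data.Fin.Properties using (toℕ<n)
import Data.Integer as ℤ
import Data.Integer.Properties as ℤ
import Data.Integer.Tactic.RingSolver as ℤ-Solver
open import Data.List using (List; []; _∷_; _++_; foldl; foldr; map; replicate; _ʳ++_; take; drop; filter; cartesianProduct; upTo)
open import Data.List.Extrema.Nat using (argmax-all)
import Data.List.Properties as List
open import Data.List.Membership.Propositional using (_∈_)
open import Data.List.Membership.Propositional.Properties using (∈-++⁺ˡ; ∈-++⁺ʳ; ∈-++⁻; ∈-map⁺; ∈-map⁻; ∈-filter⁺; ∈-filter⁻; ∈-cartesianProduct⁻; ∈-cartesianProductWith⁻; ∈-upTo⁺; ∈-upTo⁻)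
open import Data.List.Relation.Unary.All using (All; []; _∷_)
import Data.List.Relation.Unary.All as All
import Data.List.Relation.Unary.All.Properties as All
open import Data.List.Relation.Unary.Any using (Any; here; there)
import Data.List.Relation.Unary.Any as Any
import Data.List.Relation.Unary.Any.Properties as Any
open import Data.Maybe using (Maybe; just; nothing)
open import Data.Nat using (zero; suc; pred; _*_; _∸_; _<_; z≤n; s≤s; >-nonZero; _/_; _%_)
open import Data.Nat.DivMod using (m%n<n; m/n*n≤m; n/n≡1; [m+n]%n≡m%n; +-distrib-/-∣ˡ; m<n⇒m/n≡0; m<n⇒m%n≡m)
open import Data.Nat.Divisibility using (∣-refl)
open import Data.Nat.ListAction using (sum)
open import Data.Nat.ListAction.Properties using (sum-++)
open import Data.Nat.Properties
open import Data.Nat.Tactic.RingSolver using (solve-∀)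
open import Data.Product using (_,_; proj₁; proj₂)
open import Data.Rational using (½; toℚᵘ)
import Data.Rational as ℚ
import Data.Rational.Properties as ℚ
open import Data.Rational.Unnormalised as ℚᵘ using (mkℚᵘ; *≡*; *≤*)
import Data.Rational.Unnormalised.Properties as ℚᵘ
open import Data.Sum as Sum using (_⊎_; inj₁; inj₂)
open import Data.Unit using (⊤; tt)
open import Data.Vec using (Vec; []; _∷_; lookup; zipWith; toList)
import Data.Vec as Vec
import Data.Vec.Properties as Vec
open import Function using (_∘_)
open import Relation.Binary.PropositionalEquality
open import Relation.Nullary using (Dec; yes; no; contradiction; ¬?)
open import Relation.Nullary.Decidable using (_×-dec_)
open import Relation.Unary using (Decidable)

-- There is a deterministic algorithm, so that the success probability is 1.
-- For a solution r, every solution at largest distance from r is at distance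
-- at least Diam / 2, and it suffices to find a solution y with
-- k d(r, y) ≥ (k - 1) d(r, z) for all solutions z.  Write solutions as offsets
-- from r, so that the distance is the number of ones.  Local search from a
-- start c with a budget of e flips (always flip a variable of a falsified
-- clause) takes time about k^e.  On the path that leads from c towards z the
-- first solution met lacks at most the ones of z that c lacks, so it is good
-- enough if c lacks at most 1/k of the ones of z.
--
-- The starts are built from blocks of constant length L, taken from a table of
-- pairs (c, e) such that every q in {0,1}^L is within distance e of some c that
-- lacks at most 1/k of the ones of q.  If every bit of q is flipped with
-- probability 1/(k + 1), then by Markov's inequality the result lacks at most
-- 1/k of the ones of q with probability at least 1/(k + 1).  Hence greedy
-- weighted set cover yields a table for which the sum of k^e is at most
-- poly(L) (2k/(k + 1))^L.  Since (1 + 1/k)^k > 2, this is at most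
-- 2^((1 - 1/k) L) for a suitable L.

-- Programs on two registers

-- The flip probability `1 / (k + 1)` serves two ends. The odds of a flip are `1 / k`, so the
-- likelihood of a start at distance `e` is proportional to `k ^ (L - e)`, which cancels the price
-- `k ^ e`: no radius is favoured. And the expected loss `weight q / (k + 1)` stays below the
-- allowed `weight q / k` by just enough for Markov's inequality to leave a constant. The allowed
-- loss is relative to the ones of each block, so the conditions add up over the blocks however the
-- ones of a solution are spread. The table is part of the program text, hence `L` must not depend
-- on `n`. It is a multiple of `k`, which makes `(1 - 1/k) L` an integer, and the fewer than `L`
-- bits outside the blocks are enumerated at the cost of a constant factor. Termination and running
-- time both come from one potential of the worklist, in which a task with `m` undetermined bits and
-- budget `e` counts `(2 m + e + 1) k^e Θ(m)`.

infix 4 _⇒⟨_⟩_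

-- One end configuration serves for all random words, so code handled through this relation is
-- deterministic. The exact number of steps stays existential, so that bounds can be weakened.
_⇒⟨_⟩_ : ∀ {v} → Config v → ℕ → Config v → Set
c ⇒⟨ n ⟩ c′ = ∃[ m ] m ≤ n × (∀ (ω : Vec Bool m) → run ω c ≡ c′)

run-++ : ∀ {v a b} (ω : Vec Bool a) (ω′ : Vec Bool b) (c : Config v) →
         run (ω Vec.++ ω′) c ≡ run ω′ (run ω c)
run-++ []      ω′ c = refl
run-++ (b ∷ ω) ω′ c = run-++ ω ω′ (step b c)

⇒-refl : ∀ {v n} {c : Config v} → c ⇒⟨ n ⟩ c
⇒-refl = 0 , z≤n , λ { [] → refl }

⇒-trans : ∀ {v a b} {c c′ c″ : Config v} → c ⇒⟨ a ⟩ c′ → c′ ⇒⟨ b ⟩ c″ → c ⇒⟨ a + b ⟩ c″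
⇒-trans {c = c} (m , m≤a , r) (m′ , m′≤b , r′) = m + m′ , +-mono-≤ m≤a m′≤b , go
  where
  go : ∀ (ω : Vec Bool (m + m′)) → run ω c ≡ _
  go ω with Vec.splitAt m ω
  ... | ω₁ , ω₂ , refl rewrite run-++ ω₁ ω₂ c | r ω₁ = r′ ω₂

⇒-step : ∀ {v n} {c c₁ c′ : Config v} → (∀ b → step b c ≡ c₁) → c₁ ⇒⟨ n ⟩ c′ → c ⇒⟨ suc n ⟩ c′
⇒-step eq (m , m≤n , r) = suc m , s≤s m≤n , λ { (b ∷ ω) → trans (cong (run ω) (eq b)) (r ω) }

⇒-weaken : ∀ {v a b} {c c′ : Config v} → a ≤ b → c ⇒⟨ a ⟩ c′ → c ⇒⟨ b ⟩ c′
⇒-weaken a≤b (m , m≤a , r) = m , ≤-trans m≤a a≤b , r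

run-halted : ∀ {v t} {σ : Store v} (ω : Vec Bool t) → run ω ([] , σ) ≡ ([] , σ)
run-halted []      = refl
run-halted (b ∷ ω) = run-halted ω

-- A halted configuration is a fixed point of `step`, so surplus random bits change nothing.
⇒-halts : ∀ {v t} {c : Config v} {σ} → c ⇒⟨ t ⟩ ([] , σ) → (ω : Vec Bool t) → run ω c ≡ ([] , σ)
⇒-halts {t = t} {c} {σ} (m , m≤t , r) = subst (λ t → (ω : Vec Bool t) → run ω c ≡ ([] , σ)) (m+[n∸m]≡n m≤t) go
  where
  go : (ω : Vec Bool (m + (t ∸ m))) → run ω c ≡ ([] , σ)
  go ω with Vec.splitAt m ω
  ... | ω₁ , ω₂ , refl rewrite run-++ ω₁ ω₂ c | r ω₁ = run-halted ω₂

-- Programs use two registers: a working register, and a stack which every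
-- piece of code restores.
Code : Set
Code = List (Stmt 2)

x s : Expr 2
x = var zero
s = var (suc zero)

infix 4 _⊢_↦_⟨_⟩

-- An arbitrary continuation `K` permits sequencing; an arbitrary stack `S` permits running the code
-- above saved values.
record _⊢_↦_⟨_⟩ (p : Code) (t u : Tree) (n : ℕ) : Set where
  constructor runs
  field exec : ∀ S K → (p ++ K , t ∷ S ∷ []) ⇒⟨ n ⟩ (K , u ∷ S ∷ [])

open _⊢_↦_⟨_⟩

weaken : ∀ {p t u a b} → a ≤ b → p ⊢ t ↦ u ⟨ a ⟩ → p ⊢ t ↦ u ⟨ b ⟩
weaken a≤b h .exec S K = ⇒-weaken a≤b (exec h S K)

seq : ∀ {p q t u w a b} → p ⊢ t ↦ u ⟨ a ⟩ → q ⊢ u ↦ w ⟨ b ⟩ → p ++ q ⊢ t ↦ w ⟨ a + b ⟩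
seq {p} {q} f g .exec S K rewrite List.++-assoc p q K = ⇒-trans (exec f S (q ++ K)) (exec g S K)

ret : Expr 2 → Code
ret e = (zero ≔ e) ∷ []

ret-↦ : ∀ {e t u} → (∀ S → eval e (t ∷ S ∷ []) ≡ u) → ret e ⊢ t ↦ u ⟨ 1 ⟩
ret-↦ h .exec S K = ⇒-step (λ b → cong (λ u → K , u ∷ S ∷ []) (h S)) ⇒-refl

frame : Expr 2 → Expr 2 → Code → Expr 2 → Code
frame saved arg p result =
  (suc zero ≔ cons saved s) ∷ (zero ≔ arg) ∷ p ++ (zero ≔ result) ∷ (suc zero ≔ tl s) ∷ []

frame-↦ : ∀ {saved arg p result t s₀ a u w n} →
  (∀ S → eval saved (t ∷ S ∷ []) ≡ s₀) → (∀ S → eval arg (t ∷ S ∷ []) ≡ a) →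
  p ⊢ a ↦ u ⟨ n ⟩ → (∀ S → eval result (u ∷ (s₀ ∙ S) ∷ []) ≡ w) →
  frame saved arg p result ⊢ t ↦ w ⟨ 4 + n ⟩
frame-↦ {saved} {arg} {p} {result} {t} {s₀} {a} {u} {w} {n} hs ha hp hr .exec S K
  rewrite List.++-assoc p ((zero ≔ result) ∷ (suc zero ≔ tl s) ∷ []) K =
  ⇒-step (λ b → cong (λ s₁ → _ , t ∷ (s₁ ∙ S) ∷ []) (hs S))
  (⇒-step (λ b → cong (λ a → _ , a ∷ (s₀ ∙ S) ∷ []) (ha (s₀ ∙ S)))
  (⇒-weaken (≤-reflexive (+-comm n 2))
  (⇒-trans (exec hp (s₀ ∙ S) _)
  (⇒-step (λ b → cong (λ w → _ , w ∷ (s₀ ∙ S) ∷ []) (hr S))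
  (⇒-step (λ b → refl) ⇒-refl)))))

-- The caller's value is kept beside the result. Every call thus moves earlier data one `hd` deeper,
-- which accounts for the long paths in later code.
call : Expr 2 → Code → Code
call arg p = frame x arg p (cons (hd s) x)

call-↦ : ∀ {arg p t a u n} → (∀ S → eval arg (t ∷ S ∷ []) ≡ a) →
  p ⊢ a ↦ u ⟨ n ⟩ → call arg p ⊢ t ↦ t ∙ u ⟨ 4 + n ⟩
call-↦ ha hp = frame-↦ (λ S → refl) ha hp (λ S → refl)

branch : Expr 2 → Code → Code → Code
branch e p q = cond e p q ∷ []

branch-true : ∀ {e p q t u n} → (∀ S → isCons (eval e (t ∷ S ∷ [])) ≡ true) →
  p ⊢ t ↦ u ⟨ n ⟩ → branch e p q ⊢ t ↦ u ⟨ suc n ⟩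
branch-true {e} {p} {q} {t} he hp .exec S K =
  ⇒-step (λ b → cong (λ c → (if c then p else q) ++ K , t ∷ S ∷ []) (he S)) (exec hp S K)

branch-false : ∀ {e p q t u n} → (∀ S → isCons (eval e (t ∷ S ∷ [])) ≡ false) →
  q ⊢ t ↦ u ⟨ n ⟩ → branch e p q ⊢ t ↦ u ⟨ suc n ⟩
branch-false {e} {p} {q} {t} he hp .exec S K =
  ⇒-step (λ b → cong (λ c → (if c then p else q) ++ K , t ∷ S ∷ []) (he S)) (exec hp S K)

isCons-fromBool : ∀ b → isCons (fromBool b) ≡ b
isCons-fromBool false = refl
isCons-fromBool true  = refl

loop : Expr 2 → Code → Code
loop e p = while e p ∷ []

loop-exit : ∀ {e p t} → (∀ S → isCons (eval e (t ∷ S ∷ [])) ≡ false) → loop e p ⊢ t ↦ t ⟨ 1 ⟩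
loop-exit {e} {p} {t} he .exec S K =
  ⇒-step (λ b → cong (λ c → (if c then p ++ while e p ∷ K else K) , t ∷ S ∷ []) (he S)) ⇒-refl

loop-enter : ∀ {e p t u w a b} → (∀ S → isCons (eval e (t ∷ S ∷ [])) ≡ true) →
  p ⊢ t ↦ u ⟨ a ⟩ → loop e p ⊢ u ↦ w ⟨ b ⟩ → loop e p ⊢ t ↦ w ⟨ suc (a + b) ⟩
loop-enter {e} {p} {t} he hp hl .exec S K =
  ⇒-step (λ b → cong (λ c → (if c then p ++ while e p ∷ K else K) , t ∷ S ∷ []) (he S))
  (⇒-trans (exec hp S _) (exec hl S K))

fold-step : Code → Code
fold-step p = frame (tl (tl x)) (cons (hd x) (hd (tl x))) p (cons x (hd s))

fold : Code → Code
fold p = loop (tl x) (fold-step p) ++ ret (hd x)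

-- Per element, 5 is the loop test and the four assignments of `frame`; the final 2 is the failing
-- test and the closing `ret`.
fold-time : ℕ → ℕ → ℕ
fold-time l n = l * (5 + n) + 2

module _ {A B : Set} {encA : A → Tree} {encB : B → Tree} {f : B → A → B} {P : A → Set} {p : Code} {n : ℕ}
         (body : ∀ b a → P a → p ⊢ encB b ∙ encA a ↦ encB (f b a) ⟨ n ⟩) where

  fold-loop : ∀ xs b → All P xs →
    loop (tl x) (fold-step p) ⊢ encB b ∙ encodeList encA xs ↦ encB (foldl f b xs) ∙ nil ⟨ length xs * (5 + n) + 1 ⟩
  fold-loop []       b []        = loop-exit (λ S → refl)
  fold-loop (a ∷ xs) b (pa ∷ ps) =
    weaken (≤-reflexive (sym (+-assoc (5 + n) (length xs * (5 + n)) 1)))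
    (loop-enter (λ S → refl)
      (frame-↦ {s₀ = encodeList encA xs} {a = encB b ∙ encA a} {u = encB (f b a)}
         (λ S → refl) (λ S → refl) (body b a pa) (λ S → refl))
      (fold-loop xs (f b a) ps))

  fold-↦ : ∀ xs b → All P xs → fold p ⊢ encB b ∙ encodeList encA xs ↦ encB (foldl f b xs) ⟨ fold-time (length xs) n ⟩
  fold-↦ xs b ps =
    weaken (≤-reflexive (+-assoc (length xs * (5 + n)) 1 1))
    (seq (fold-loop xs b ps) (ret-↦ (λ S → refl)))

-- Subroutines

bits : List Bool → Tree
bits = encodeList fromBool

-- Positions past the end read as false, in agreement with `hd` of nil and with `decode`. Hence `[]`
-- can serve as the all-false reference.
bit : List Bool → ℕ → Bool
bit []       i       = false
bit (b ∷ bs) zero    = b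
bit (b ∷ bs) (suc i) = bit bs i

flipAt : ℕ → List Bool → List Bool
flipAt i       []       = not false ∷ []
flipAt zero    (b ∷ bs) = not b ∷ bs
flipAt (suc i) (b ∷ bs) = b ∷ flipAt i bs

weight : List Bool → ℕ
weight []           = 0
weight (false ∷ bs) = weight bs
weight (true ∷ bs)  = suc (weight bs)

xorWith : List Bool → List Bool → List Bool
xorWith r []       = []
xorWith r (b ∷ bs) = (bit r 0 xor b) ∷ xorWith (drop 1 r) bs

fold-time-mono : ∀ {l l′} n → l ≤ l′ → fold-time l n ≤ fold-time l′ n
fold-time-mono n l≤l′ = +-monoˡ-≤ 2 (*-monoˡ-≤ (5 + n) l≤l′)

-- Unary numbers are lists of units, so `fold` doubles as a counting loop.
encodeℕ-list : ∀ n → encodeℕ n ≡ encodeList (λ (_ : ⊤) → nil) (replicate n tt)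
encodeℕ-list zero    = refl
encodeℕ-list (suc n) = cong (nil ∙_) (encodeℕ-list n)

fold-ℕ-↦ : ∀ {B : Set} {encB : B → Tree} {f : B → B} {p : Code} {n} →
  (∀ b → p ⊢ encB b ∙ nil ↦ encB (f b) ⟨ n ⟩) →
  ∀ i b → fold p ⊢ encB b ∙ encodeℕ i ↦ encB (foldl (λ b _ → f b) b (replicate i tt)) ⟨ fold-time i n ⟩
fold-ℕ-↦ {encB = encB} {f} {p} {n} body i b rewrite encodeℕ-list i =
  subst (λ l → fold p ⊢ encB b ∙ encodeList (λ _ → nil) (replicate i tt) ↦ encB (foldl (λ b _ → f b) b (replicate i tt)) ⟨ fold-time l n ⟩)
    (List.length-replicate i)
    (fold-↦ {encA = λ (_ : ⊤) → nil} {f = λ b _ → f b} {P = λ _ → ⊤} (λ b _ _ → body b) (replicate i tt) b (All.universal (λ _ → tt) _))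

tls : ℕ → Tree → Tree
tls zero    t = t
tls (suc i) t = tls i (tlᵗ t)

tls-nil : ∀ i → tls i nil ≡ nil
tls-nil zero    = refl
tls-nil (suc i) = tls-nil i

hd-tls-bits : ∀ i y → hdᵗ (tls i (bits y)) ≡ fromBool (bit y i)
hd-tls-bits i       []      = cong hdᵗ (tls-nil i)
hd-tls-bits zero    (b ∷ y) = refl
hd-tls-bits (suc i) (b ∷ y) = hd-tls-bits i y

tls-encodeℕ : ∀ i m → tls i (encodeℕ m) ≡ encodeℕ (m ∸ i)
tls-encodeℕ zero    m       = refl
tls-encodeℕ (suc i) zero    = tls-nil i
tls-encodeℕ (suc i) (suc m) = tls-encodeℕ i m

foldl-tls : ∀ i t → foldl (λ t _ → tlᵗ t) t (replicate i tt) ≡ tls i t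
foldl-tls zero    t = refl
foldl-tls (suc i) t = foldl-tls i (tlᵗ t)

drop-code : Code
drop-code = fold (ret (tl (hd x)))

drop-↦ : ∀ t i → drop-code ⊢ t ∙ encodeℕ i ↦ tls i t ⟨ fold-time i 1 ⟩
drop-↦ t i = subst (λ u → drop-code ⊢ t ∙ encodeℕ i ↦ u ⟨ fold-time i 1 ⟩) (foldl-tls i t)
  (fold-ℕ-↦ {encB = λ t → t} {f = tlᵗ} (λ b → ret-↦ (λ S → refl)) i t)

bit-code : Code
bit-code = drop-code ++ ret (hd x)

bit-time : ℕ → ℕ
bit-time n = fold-time n 1 + 1

bit-↦ : ∀ {n} y i → i ≤ n → bit-code ⊢ bits y ∙ encodeℕ i ↦ fromBool (bit y i) ⟨ bit-time n ⟩
bit-↦ y i i≤n = seq (weaken (fold-time-mono 1 i≤n) (drop-↦ (bits y) i)) (ret-↦ (λ S → hd-tls-bits i y))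

xor-code : Code
xor-code = branch (hd x) (branch (tl x) (ret nil) (ret (cons nil nil))) (ret (tl x))

xor-↦ : ∀ a b → xor-code ⊢ fromBool a ∙ fromBool b ↦ fromBool (a xor b) ⟨ 3 ⟩
xor-↦ false b     = weaken (n≤1+n 2) (branch-false (λ S → refl) (ret-↦ (λ S → refl)))
xor-↦ true  false = branch-true (λ S → refl) (branch-false (λ S → refl) (ret-↦ (λ S → refl)))
xor-↦ true  true  = branch-true (λ S → refl) (branch-true (λ S → refl) (ret-↦ (λ S → refl)))

-- Assignments are searched as offsets y from a reference assignment r, so
-- that the distance from r is the weight of y.
falsifies : ∀ {n} → List Bool → List Bool → Literal n → Bool
falsifies r y (i , b) = b xor (bit r (toℕ i) xor bit y (toℕ i))

falsifies-code : Code
falsifies-code =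
  call (cons (hd (hd x)) (hd (tl x))) bit-code ++
  call (cons (tl (hd (hd x))) (hd (tl (hd x)))) bit-code ++
  call (cons (tl (hd x)) (tl x)) xor-code ++
  ret (cons (tl (tl (hd (hd (hd x))))) (tl x)) ++
  xor-code

falsifies-time : ℕ → ℕ
falsifies-time n = (4 + bit-time n) + ((4 + bit-time n) + 11)

falsifies-↦ : ∀ {n} r y (l : Literal n) →
  falsifies-code ⊢ (bits r ∙ bits y) ∙ encodeLiteral l ↦ fromBool (falsifies r y l) ⟨ falsifies-time n ⟩
falsifies-↦ r y (i , b) =
  seq (call-↦ (λ S → refl) (bit-↦ r (toℕ i) (<⇒≤ (toℕ<n i))))
  (seq (call-↦ (λ S → refl) (bit-↦ y (toℕ i) (<⇒≤ (toℕ<n i))))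
  (seq (call-↦ (λ S → refl) (xor-↦ (bit r (toℕ i)) (bit y (toℕ i))))
  (seq (ret-↦ (λ S → refl))
  (xor-↦ b _))))

falsifiesClause : ∀ {n} → List Bool → List Bool → Clause n → Bool
falsifiesClause r y = foldl (λ b l → if b then falsifies r y l else false) true

clause-code : Code
clause-code = fold (branch (tl (hd x))
  (call (cons (hd (hd x)) (tl x)) falsifies-code ++ ret (cons (hd (hd (hd x))) (tl x)))
  (ret (hd x)))

clause-time : ℕ → ℕ → ℕ
clause-time k n = fold-time k (suc (4 + falsifies-time n + 1))

clause-↦ : ∀ {k n} r y (C : Clause n) → length C ≤ k →
  clause-code ⊢ ((bits r ∙ bits y) ∙ fromBool true) ∙ encodeList encodeLiteral C
    ↦ (bits r ∙ bits y) ∙ fromBool (falsifiesClause r y C) ⟨ clause-time k n ⟩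
clause-↦ {k} {n} r y C C≤k = weaken (fold-time-mono _ C≤k)
  (fold-↦ {encB = λ b → (bits r ∙ bits y) ∙ fromBool b} {P = λ _ → ⊤}
    (λ { true  l _ → branch-true (λ S → refl) (seq (call-↦ (λ S → refl) (falsifies-↦ r y l)) (ret-↦ (λ S → refl)))
       ; false l _ → weaken (s≤s (s≤s z≤n)) (branch-false (λ S → refl) (ret-↦ (λ S → refl))) })
    C true (All.universal (λ _ → tt) C))

findFalsified-step : ∀ {n} → List Bool → List Bool → Maybe (Clause n) → Clause n → Maybe (Clause n)
findFalsified-step r y (just C) D = just C
findFalsified-step r y nothing  D = if falsifiesClause r y D then just D else nothing

findFalsified : ∀ {n} → List Bool → List Bool → CNF n → Maybe (Clause n)
findFalsified r y = foldl (findFalsified-step r y) nothing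

encodeMaybe : ∀ {n} → Maybe (Clause n) → Tree
encodeMaybe nothing  = nil
encodeMaybe (just C) = nil ∙ encodeList encodeLiteral C

find-body : Code
find-body = branch (tl (hd x))
  (ret (hd x))
  (call (cons (cons (hd (hd x)) (cons nil nil)) (tl x)) clause-code ++
   branch (tl (tl x))
     (ret (cons (hd (hd (hd x))) (cons nil (tl (hd x)))))
     (ret (hd (hd x))))

find-code : Code
find-code = fold find-body

find-time : ℕ → ℕ → ℕ → ℕ
find-time k m n = fold-time m (suc (4 + clause-time k n + 2))

find-↦ : ∀ {k n} r y (F : CNF n) → IsKCNF k F →
  find-code ⊢ ((bits r ∙ bits y) ∙ nil) ∙ encodeList (encodeList encodeLiteral) F
    ↦ (bits r ∙ bits y) ∙ encodeMaybe (findFalsified r y F) ⟨ find-time k (length F) n ⟩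
find-↦ {k} {n} r y F kF =
  fold-↦ {encB = λ m → (bits r ∙ bits y) ∙ encodeMaybe m} {P = λ C → length C ≤ k} body F nothing kF
  where
  body : ∀ m C → length C ≤ k → find-body ⊢ ((bits r ∙ bits y) ∙ encodeMaybe m) ∙ encodeList encodeLiteral C
    ↦ (bits r ∙ bits y) ∙ encodeMaybe (findFalsified-step r y m C) ⟨ suc (4 + clause-time k n + 2) ⟩
  body (just D) C C≤k = weaken (s≤s (s≤s z≤n)) (branch-true (λ S → refl) (ret-↦ (λ S → refl)))
  body nothing  C C≤k = branch-false (λ S → refl) (seq (call-↦ (λ S → refl) (clause-↦ r y C C≤k)) rest)
    where
    rest : branch (tl (tl x)) (ret (cons (hd (hd (hd x))) (cons nil (tl (hd x))))) (ret (hd (hd x))) ⊢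
      (((bits r ∙ bits y) ∙ nil) ∙ encodeList encodeLiteral C) ∙ ((bits r ∙ bits y) ∙ fromBool (falsifiesClause r y C))
      ↦ (bits r ∙ bits y) ∙ encodeMaybe (if falsifiesClause r y C then just C else nothing) ⟨ 2 ⟩
    rest with falsifiesClause r y C
    ... | true  = branch-true (λ S → refl) (ret-↦ (λ S → refl))
    ... | false = branch-false (λ S → refl) (ret-↦ (λ S → refl))

reverse-code : Code
reverse-code = fold (ret (cons (tl x) (hd x)))

foldl-∷ : ∀ {A : Set} (xs ys : List A) → foldl (λ acc a → a ∷ acc) ys xs ≡ xs ʳ++ ys
foldl-∷ []       ys = refl
foldl-∷ (a ∷ xs) ys = foldl-∷ xs (a ∷ ys)

reverse-↦ : ∀ {n} xs ys → length xs ≤ n → reverse-code ⊢ bits ys ∙ bits xs ↦ bits (xs ʳ++ ys) ⟨ fold-time n 1 ⟩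
reverse-↦ xs ys xs≤n = weaken (fold-time-mono 1 xs≤n)
  (subst (λ zs → reverse-code ⊢ bits ys ∙ bits xs ↦ bits zs ⟨ fold-time (length xs) 1 ⟩) (foldl-∷ xs ys)
  (fold-↦ {encB = bits} {P = λ _ → ⊤} (λ ys b _ → ret-↦ (λ S → refl)) xs ys (All.universal (λ _ → tt) xs)))

-- A zipper with reversed prefix: the bit at depth `i` is reached by `i` such moves, negated, and
-- the prefix is unwound by a reversal.
flip-step : List Bool × List Bool → List Bool × List Bool
flip-step (p , [])    = false ∷ p , []
flip-step (p , b ∷ q) = b ∷ p , q

encodeZipper : List Bool × List Bool → Tree
encodeZipper (p , q) = bits p ∙ bits q

flip-code : Code
flip-code =
  ret (cons (cons nil (hd x)) (tl x)) ++
  fold (ret (cons (cons (hd (tl (hd x))) (hd (hd x))) (tl (tl (hd x))))) ++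
  branch (hd (tl x))
    (ret (cons (cons nil (tl (tl x))) (hd x)))
    (ret (cons (cons (cons nil nil) (tl (tl x))) (hd x))) ++
  reverse-code

flip-time : ℕ → ℕ
flip-time n = 1 + (fold-time n 1 + (2 + fold-time n 1))

flip-here : List Bool → List Bool
flip-here []      = not false ∷ []
flip-here (b ∷ q) = not b ∷ q

flip-zipper : ∀ i p y → i < length y →
  let (p′ , q′) = foldl (λ z _ → flip-step z) (p , y) (replicate i tt)
  in length p′ ≡ i + length p × p′ ʳ++ flip-here q′ ≡ p ʳ++ flipAt i y
flip-zipper zero    p (b ∷ y) _         = refl , refl
flip-zipper (suc i) p (b ∷ y) (s≤s i<l) =
  let (l , e) = flip-zipper i (b ∷ p) y i<l in trans l (+-suc i (length p)) , e

flip-↦ : ∀ {n} y i → i < n → n ≤ length y → flip-code ⊢ bits y ∙ encodeℕ i ↦ bits (flipAt i y) ⟨ flip-time n ⟩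
flip-↦ {n} y i i<n n≤l with foldl (λ z _ → flip-step z) ([] , y) (replicate i tt)
                          | flip-zipper i [] y (≤-trans i<n n≤l)
                          | fold-ℕ-↦ {encB = encodeZipper} {f = flip-step} {p = ret (cons (cons (hd (tl (hd x))) (hd (hd x))) (tl (tl (hd x))))} {n = 1}
                              (λ { (p , []) → ret-↦ (λ S → refl) ; (p , b ∷ q) → ret-↦ (λ S → refl) }) i ([] , y)
... | p , q | |p|≡ , eq | h =
  seq (ret-↦ (λ S → refl)) (seq (weaken (fold-time-mono 1 (<⇒≤ i<n)) h) (seq (negate q) rev))
  where
  rev : reverse-code ⊢ bits (flip-here q) ∙ bits p ↦ bits (flipAt i y) ⟨ fold-time n 1 ⟩
  rev = subst (λ z → reverse-code ⊢ bits (flip-here q) ∙ bits p ↦ bits z ⟨ fold-time n 1 ⟩) eq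
          (reverse-↦ p (flip-here q) (≤-trans (≤-reflexive (trans |p|≡ (+-identityʳ i))) (<⇒≤ i<n)))
  negate : ∀ q → branch (hd (tl x)) _ _ ⊢ bits p ∙ bits q ↦ bits (flip-here q) ∙ bits p ⟨ 2 ⟩
  negate []          = branch-false (λ S → refl) (ret-↦ (λ S → refl))
  negate (true ∷ q)  = branch-true (λ S → refl) (ret-↦ (λ S → refl))
  negate (false ∷ q) = branch-false (λ S → refl) (ret-↦ (λ S → refl))

weight-code : Code
weight-code = ret (cons nil x) ++ fold (branch (tl x) (ret (cons nil (hd x))) (ret (hd x)))

weight-time : ℕ → ℕ
weight-time n = 1 + fold-time n 2

foldl-weight : ∀ y m → foldl (λ m b → if b then suc m else m) m y ≡ m + weight y
foldl-weight []          m = sym (+-identityʳ m)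
foldl-weight (false ∷ y) m = foldl-weight y m
foldl-weight (true ∷ y)  m = trans (foldl-weight y (suc m)) (sym (+-suc m (weight y)))

weight-↦ : ∀ {n} y → length y ≤ n → weight-code ⊢ bits y ↦ encodeℕ (weight y) ⟨ weight-time n ⟩
weight-↦ {n} y y≤n = seq (ret-↦ (λ S → refl)) (weaken (fold-time-mono 2 y≤n)
  (subst (λ m → fold (branch _ _ _) ⊢ nil ∙ bits y ↦ encodeℕ m ⟨ fold-time (length y) 2 ⟩) (foldl-weight y 0)
  (fold-↦ {encB = encodeℕ} {f = λ m b → if b then suc m else m} {P = λ _ → ⊤}
    (λ { m true  _ → branch-true (λ S → refl) (ret-↦ (λ S → refl))
       ; m false _ → branch-false (λ S → refl) (ret-↦ (λ S → refl)) }) y 0 (All.universal (λ _ → tt) y))))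

weight≤length : ∀ y → weight y ≤ length y
weight≤length []          = z≤n
weight≤length (false ∷ y) = m≤n⇒m≤1+n (weight≤length y)
weight≤length (true ∷ y)  = s≤s (weight≤length y)

-- Weights are compared by truncated subtraction in unary, since the machine can drop cells and test
-- for nil. A tie goes to the second argument, so a first solution replaces the placeholder `[]`
-- even if its weight is 0.
heavier : List Bool → List Bool → List Bool
heavier y z = if isCons (encodeℕ (weight y ∸ weight z)) then y else z

heavier-code : Code
heavier-code =
  call (hd x) weight-code ++
  call (tl (hd x)) weight-code ++
  call (cons (tl (hd x)) (tl x)) drop-code ++
  branch (tl x) (ret (hd (hd (hd (hd x))))) (ret (tl (hd (hd (hd x)))))

heavier-time : ℕ → ℕ
heavier-time n = (4 + weight-time n) + ((4 + weight-time n) + ((4 + fold-time n 1) + 2))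

heavier-↦ : ∀ {n} y z → length y ≤ n → length z ≤ n →
  heavier-code ⊢ bits y ∙ bits z ↦ bits (heavier y z) ⟨ heavier-time n ⟩
heavier-↦ {n} y z y≤n z≤n′ =
  seq (call-↦ (λ S → refl) (weight-↦ y y≤n))
  (seq (call-↦ (λ S → refl) (weight-↦ z z≤n′))
  (seq (call-↦ (λ S → refl) (weaken (fold-time-mono 1 (≤-trans (weight≤length z) z≤n′))
         (subst (λ u → drop-code ⊢ encodeℕ (weight y) ∙ encodeℕ (weight z) ↦ u ⟨ fold-time (weight z) 1 ⟩)
           (tls-encodeℕ (weight z) (weight y)) (drop-↦ (encodeℕ (weight y)) (weight z)))))
  (choose (encodeℕ (weight y ∸ weight z)))))
  where
  choose : ∀ t → branch (tl x) _ _ ⊢ (((bits y ∙ bits z) ∙ _) ∙ _) ∙ t ↦ bits (if isCons t then y else z) ⟨ 2 ⟩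
  choose nil     = branch-false (λ S → refl) (ret-↦ (λ S → refl))
  choose (_ ∙ _) = branch-true (λ S → refl) (ret-↦ (λ S → refl))

xorWith-body : Code
xorWith-body =
  call (cons (hd (hd (hd x))) (tl x)) xor-code ++
  ret (cons (tl (hd (hd (hd x)))) (cons (tl x) (tl (hd (hd x)))))

xorWith-code : Code
xorWith-code =
  ret (cons (cons (hd x) nil) (tl x)) ++
  fold xorWith-body ++
  ret (cons nil (tl x)) ++
  reverse-code

xorWith-time : ℕ → ℕ
xorWith-time n = 1 + (fold-time n 8 + (1 + fold-time n 1))

xorWith-step : List Bool × List Bool → Bool → List Bool × List Bool
xorWith-step (r , out) b = drop 1 r , (bit r 0 xor b) ∷ out

foldl-xorWith : ∀ r y out → proj₂ (foldl xorWith-step (r , out) y) ≡ xorWith r y ʳ++ out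
foldl-xorWith r []      out = refl
foldl-xorWith r (b ∷ y) out = foldl-xorWith (drop 1 r) y ((bit r 0 xor b) ∷ out)

length-xorWith : ∀ r y → length (xorWith r y) ≡ length y
length-xorWith r []      = refl
length-xorWith r (b ∷ y) = cong suc (length-xorWith _ y)

xorWith-↦ : ∀ {n} r y → length y ≤ n → xorWith-code ⊢ bits r ∙ bits y ↦ bits (xorWith r y) ⟨ xorWith-time n ⟩
xorWith-↦ {n} r y y≤n =
  seq (ret-↦ (λ S → refl))
  (seq (weaken (fold-time-mono 8 y≤n)
    (fold-↦ {encB = encodeZipper} {f = xorWith-step} {P = λ _ → ⊤} body y (r , []) (All.universal (λ _ → tt) y)))
  (seq (ret-↦ {u = nil ∙ bits (xorWith r y ʳ++ [])} (λ S → cong (λ z → nil ∙ bits z) (foldl-xorWith r y [])))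
  (subst (λ z → reverse-code ⊢ nil ∙ bits (xorWith r y ʳ++ []) ↦ bits z ⟨ fold-time n 1 ⟩)
    (trans (List.ʳ++-ʳ++ (xorWith r y)) (List.++-identityʳ _))
    (reverse-↦ (xorWith r y ʳ++ []) []
      (≤-trans (≤-reflexive (trans (List.length-ʳ++ (xorWith r y)) (trans (+-identityʳ _) (length-xorWith r y)))) y≤n)))))
  where
  body : ∀ z b → ⊤ → xorWith-body ⊢ encodeZipper z ∙ fromBool b ↦ encodeZipper (xorWith-step z b) ⟨ 8 ⟩
  body ([] , out)    b _ = seq (call-↦ (λ S → refl) (xor-↦ false b)) (ret-↦ (λ S → refl))
  body (a ∷ r , out) b _ = seq (call-↦ (λ S → refl) (xor-↦ a b)) (ret-↦ (λ S → refl))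

-- The worklist search

-- A task (m , r , y) stands for the assignments that end in a suffix at
-- distance at most r from y, with the first m bits still undetermined.
Task : Set
Task = ℕ × ℕ × List Bool

encodeTask : Task → Tree
encodeTask (m , r , y) = encodeℕ m ∙ (encodeℕ r ∙ bits y)

children-step : ∀ {n} → ℕ → List Bool → List Task → Literal n → List Task
children-step r y W (i , _) = (0 , r , flipAt (toℕ i) y) ∷ W

children : ∀ {n} → ℕ → List Bool → List Task → Clause n → List Task
children r y = foldl (children-step r y)

children-body : Code
children-body =
  call (cons (tl (hd (hd x))) (hd (tl x))) flip-code ++
  ret (cons (hd (hd (hd x))) (cons (cons nil (cons (hd (hd (hd (hd x)))) (tl x))) (tl (hd (hd x)))))

children-code : Code
children-code = fold children-body

children-time : ℕ → ℕ → ℕ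
children-time k n = fold-time k (4 + flip-time n + 1)

children-↦ : ∀ {k n} r y W (C : Clause n) → length C ≤ k → length y ≡ n →
  children-code ⊢ ((encodeℕ r ∙ bits y) ∙ encodeList encodeTask W) ∙ encodeList encodeLiteral C
    ↦ (encodeℕ r ∙ bits y) ∙ encodeList encodeTask (children r y W C) ⟨ children-time k n ⟩
children-↦ {k} {n} r y W C C≤k y≡n = weaken (fold-time-mono _ C≤k)
  (fold-↦ {encB = λ W → (encodeℕ r ∙ bits y) ∙ encodeList encodeTask W} {P = λ _ → ⊤}
    (λ { W (i , b) _ → seq (call-↦ (λ S → refl) (flip-↦ y (toℕ i) (toℕ<n i) (≤-reflexive (sym y≡n)))) (ret-↦ (λ S → refl)) })
    C W (All.universal (λ _ → tt) C))

-- An entry (c , r) of a table stands for the ball of radius r around c.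
Table : Set
Table = List (List Bool × ℕ)

expand : ℕ → Table → Task → List Task → List Task
expand l table (m , r , y) W = foldr (λ (c , a) W → (m ∸ l , a + r , c ++ y) ∷ W) W table

tlsᵉ : ℕ → Expr 2 → Expr 2
tlsᵉ zero    e = e
tlsᵉ (suc i) e = tlsᵉ i (tl e)

eval-tlsᵉ : ∀ i e σ → eval (tlsᵉ i e) σ ≡ tls i (eval e σ)
eval-tlsᵉ zero    e σ = refl
eval-tlsᵉ (suc i) e σ = eval-tlsᵉ i (tl e) σ

sucsᵉ : ℕ → Expr 2 → Expr 2
sucsᵉ zero    e = e
sucsᵉ (suc a) e = cons nil (sucsᵉ a e)

eval-sucsᵉ : ∀ a {e σ r} → eval e σ ≡ encodeℕ r → eval (sucsᵉ a e) σ ≡ encodeℕ (a + r)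
eval-sucsᵉ zero    h = h
eval-sucsᵉ (suc a) h = cong (nil ∙_) (eval-sucsᵉ a h)

boolᵉ : Bool → Expr 2
boolᵉ false = nil
boolᵉ true  = cons nil nil

eval-boolᵉ : ∀ b σ → eval (boolᵉ b) σ ≡ fromBool b
eval-boolᵉ false σ = refl
eval-boolᵉ true  σ = refl

prependᵉ : List Bool → Expr 2 → Expr 2
prependᵉ []      e = e
prependᵉ (b ∷ c) e = cons (boolᵉ b) (prependᵉ c e)

eval-prependᵉ : ∀ c {e σ y} → eval e σ ≡ bits y → eval (prependᵉ c e) σ ≡ bits (c ++ y)
eval-prependᵉ []      h = h
eval-prependᵉ (b ∷ c) h = cong₂ _∙_ (eval-boolᵉ b _) (eval-prependᵉ c h)

-- The table is unrolled into a single expression, so that a whole expansion is one assignment.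
expandᵉ : ℕ → Table → (m r y W : Expr 2) → Expr 2
expandᵉ l []              m r y W = W
expandᵉ l ((c , a) ∷ tab) m r y W =
  cons (cons (tlsᵉ l m) (cons (sucsᵉ a r) (prependᵉ c y))) (expandᵉ l tab m r y W)

eval-expandᵉ : ∀ l tab {σ m r y W mᵉ rᵉ yᵉ Wᵉ} → eval mᵉ σ ≡ encodeℕ m → eval rᵉ σ ≡ encodeℕ r →
  eval yᵉ σ ≡ bits y → eval Wᵉ σ ≡ encodeList encodeTask W →
  eval (expandᵉ l tab mᵉ rᵉ yᵉ Wᵉ) σ ≡ encodeList encodeTask (expand l tab (m , r , y) W)
eval-expandᵉ l []              hm hr hy hW = hW
eval-expandᵉ l ((c , a) ∷ tab) {σ} {m} {mᵉ = mᵉ} hm hr hy hW =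
  cong₂ _∙_
    (cong₂ _∙_ (trans (eval-tlsᵉ l mᵉ σ) (trans (cong (tls l) hm) (tls-encodeℕ l m)))
               (cong₂ _∙_ (eval-sucsᵉ a hr) (eval-prependᵉ c hy)))
    (eval-expandᵉ l tab hm hr hy hW)

-- Plain enumeration of one bit, for the bits that do not fill a block.
unitTable : Table
unitTable = (false ∷ [] , 0) ∷ (true ∷ [] , 0) ∷ []

-- Solutions as offsets and falsified clauses

Sol : ∀ {n} → List Bool → CNF n → List Bool → Set
Sol r F y = All (Any (λ (i , b) → bit r (toℕ i) xor bit y (toℕ i) ≡ b)) F

xor-false : ∀ a b → b xor a ≡ false → a ≡ b
xor-false false false _ = refl
xor-false true  true  _ = refl

xor-true : ∀ a b → b xor a ≡ true → a ≢ b
xor-true false true  _ ()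
xor-true true  false _ ()

module _ {n : ℕ} (r y : List Bool) where

  private
    and-step : Bool → Literal n → Bool
    and-step b l = if b then falsifies r y l else false

  foldl-false : ∀ C → foldl and-step false C ≡ false
  foldl-false []      = refl
  foldl-false (l ∷ C) = foldl-false C

  falsifiesClause-true : ∀ (C : Clause n) → falsifiesClause r y C ≡ true → All (λ l → falsifies r y l ≡ true) C
  falsifiesClause-true []      _ = []
  falsifiesClause-true (l ∷ C) h with falsifies r y l in eq
  ... | true  = eq ∷ falsifiesClause-true C h
  ... | false with () ← trans (sym (foldl-false C)) h

  falsifiesClause-false : ∀ (C : Clause n) → falsifiesClause r y C ≡ false →
    Any (λ (i , b) → bit r (toℕ i) xor bit y (toℕ i) ≡ b) C
  falsifiesClause-false (l ∷ C) h with falsifies r y l in eq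
  ... | true  = there (falsifiesClause-false C h)
  ... | false = here (xor-false _ _ eq)

  foldl-just : ∀ {D} (F : CNF n) → foldl (findFalsified-step r y) (just D) F ≡ just D
  foldl-just []      = refl
  foldl-just (C ∷ F) = foldl-just F

  findFalsified-nothing : ∀ (F : CNF n) → findFalsified r y F ≡ nothing → Sol r F y
  findFalsified-nothing []      _ = []
  findFalsified-nothing (C ∷ F) h with falsifiesClause r y C in eq
  ... | true with () ← trans (sym (foldl-just F)) h
  ... | false = falsifiesClause-false C eq ∷ findFalsified-nothing F h

  findFalsified-just : ∀ {D} (F : CNF n) → findFalsified r y F ≡ just D → D ∈ F × All (λ l → falsifies r y l ≡ true) D
  findFalsified-just (C ∷ F) h with falsifiesClause r y C in eq
  ... | true with refl ← trans (sym (foldl-just F)) h = here refl , falsifiesClause-true C eq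
  ... | false = let (D∈F , f) = findFalsified-just F h in there D∈F , f

-- Hamming distance and lacking ones

ham : List Bool → List Bool → ℕ
ham (false ∷ c) (true ∷ q)  = suc (ham c q)
ham (true ∷ c)  (false ∷ q) = suc (ham c q)
ham (_ ∷ c)     (_ ∷ q)     = ham c q
ham _           _           = 0

-- The part of the Hamming distance made up of the ones of the second word that the first lacks.
up : List Bool → List Bool → ℕ
up (false ∷ c) (true ∷ q) = suc (up c q)
up (_ ∷ c)     (_ ∷ q)    = up c q
up _           _          = 0

ham-++ : ∀ c q {y s} → length c ≡ length q → ham (c ++ y) (q ++ s) ≡ ham c q + ham y s
ham-++ []          []          _ = refl
ham-++ (false ∷ c) (false ∷ q) e = ham-++ c q (suc-injective e)
ham-++ (false ∷ c) (true ∷ q)  e = cong suc (ham-++ c q (suc-injective e))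
ham-++ (true ∷ c)  (false ∷ q) e = cong suc (ham-++ c q (suc-injective e))
ham-++ (true ∷ c)  (true ∷ q)  e = ham-++ c q (suc-injective e)

up-++ : ∀ c q {y s} → length c ≡ length q → up (c ++ y) (q ++ s) ≡ up c q + up y s
up-++ []          []          _ = refl
up-++ (false ∷ c) (false ∷ q) e = up-++ c q (suc-injective e)
up-++ (false ∷ c) (true ∷ q)  e = cong suc (up-++ c q (suc-injective e))
up-++ (true ∷ c)  (false ∷ q) e = up-++ c q (suc-injective e)
up-++ (true ∷ c)  (true ∷ q)  e = up-++ c q (suc-injective e)

weight-++ : ∀ c {y} → weight (c ++ y) ≡ weight c + weight y
weight-++ []          = refl
weight-++ (false ∷ c) = weight-++ c
weight-++ (true ∷ c)  = cong suc (weight-++ c)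

weight≤weight+up : ∀ y z → length y ≡ length z → weight z ≤ weight y + up y z
weight≤weight+up []          []          _ = z≤n
weight≤weight+up (false ∷ y) (false ∷ z) e = weight≤weight+up y z (suc-injective e)
weight≤weight+up (false ∷ y) (true ∷ z)  e =
  ≤-trans (s≤s (weight≤weight+up y z (suc-injective e))) (≤-reflexive (sym (+-suc (weight y) (up y z))))
weight≤weight+up (true ∷ y)  (false ∷ z) e = m≤n⇒m≤1+n (weight≤weight+up y z (suc-injective e))
weight≤weight+up (true ∷ y)  (true ∷ z)  e = s≤s (weight≤weight+up y z (suc-injective e))

length-flipAt : ∀ i y → i < length y → length (flipAt i y) ≡ length y
length-flipAt zero    (b ∷ y) _         = refl
length-flipAt (suc i) (b ∷ y) (s≤s i<l) = cong suc (length-flipAt i y i<l)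

ham-flipAt : ∀ i y z → i < length y → length y ≡ length z → bit y i ≢ bit z i → suc (ham (flipAt i y) z) ≡ ham y z
ham-flipAt zero    (false ∷ y) (false ∷ z) _         e h = ⊥-elim (h refl)
ham-flipAt zero    (false ∷ y) (true ∷ z)  _         e h = refl
ham-flipAt zero    (true ∷ y)  (false ∷ z) _         e h = refl
ham-flipAt zero    (true ∷ y)  (true ∷ z)  _         e h = ⊥-elim (h refl)
ham-flipAt (suc i) (false ∷ y) (false ∷ z) (s≤s i<l) e h = ham-flipAt i y z i<l (suc-injective e) h
ham-flipAt (suc i) (false ∷ y) (true ∷ z)  (s≤s i<l) e h = cong suc (ham-flipAt i y z i<l (suc-injective e) h)
ham-flipAt (suc i) (true ∷ y)  (false ∷ z) (s≤s i<l) e h = cong suc (ham-flipAt i y z i<l (suc-injective e) h)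
ham-flipAt (suc i) (true ∷ y)  (true ∷ z)  (s≤s i<l) e h = ham-flipAt i y z i<l (suc-injective e) h

-- A disagreeing bit is either a lacking one, which the flip supplies, or a surplus one, whose
-- removal leaves `up` as it is.
up-flipAt : ∀ i y z → i < length y → length y ≡ length z → bit y i ≢ bit z i → up (flipAt i y) z ≤ up y z
up-flipAt zero    (false ∷ y) (false ∷ z) _         e h = ⊥-elim (h refl)
up-flipAt zero    (false ∷ y) (true ∷ z)  _         e h = n≤1+n _
up-flipAt zero    (true ∷ y)  (false ∷ z) _         e h = ≤-refl
up-flipAt zero    (true ∷ y)  (true ∷ z)  _         e h = ⊥-elim (h refl)
up-flipAt (suc i) (false ∷ y) (false ∷ z) (s≤s i<l) e h = up-flipAt i y z i<l (suc-injective e) h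
up-flipAt (suc i) (false ∷ y) (true ∷ z)  (s≤s i<l) e h = s≤s (up-flipAt i y z i<l (suc-injective e) h)
up-flipAt (suc i) (true ∷ y)  (false ∷ z) (s≤s i<l) e h = up-flipAt i y z i<l (suc-injective e) h
up-flipAt (suc i) (true ∷ y)  (true ∷ z)  (s≤s i<l) e h = up-flipAt i y z i<l (suc-injective e) h

-- Of the bits of y that differ from z, those that are 0 are what can make a
-- solution found on the way from y to z lighter than z.
record Close (k r : ℕ) (y z : List Bool) : Set where
  constructor close
  field
    length-≡ : length y ≡ length z
    ham-≤    : ham y z ≤ r
    up-≤     : k * up y z ≤ weight z

-- Distance, lacking ones and weight are all additive under concatenation, so per-block guarantees
-- combine into a guarantee for the whole word.
close-++ : ∀ {k r₁ r₂ c q y s} → Close k r₁ c q → Close k r₂ y s → Close k (r₁ + r₂) (c ++ y) (q ++ s)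
close-++ {k} {r₁} {r₂} {c} {q} {y} {s} (close l₁ h₁ u₁) (close l₂ h₂ u₂) = close
  (trans (List.length-++ c) (trans (cong₂ _+_ l₁ l₂) (sym (List.length-++ q))))
  (≤-trans (≤-reflexive (ham-++ c q l₁)) (+-mono-≤ h₁ h₂))
  (begin
    k * up (c ++ y) (q ++ s)    ≡⟨ cong (k *_) (up-++ c q l₁) ⟩
    k * (up c q + up y s)       ≡⟨ *-distribˡ-+ k (up c q) (up y s) ⟩
    k * up c q + k * up y s     ≤⟨ +-mono-≤ u₁ u₂ ⟩
    weight q + weight s         ≡⟨ sym (weight-++ q) ⟩
    weight (q ++ s)             ∎)
  where open ≤-Reasoning

-- By `a ≤ l` an expansion raises the budget by at most the number of bits that it determines; the
-- potential `Φ` relies on this.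
record IsTable (k l : ℕ) (table : Table) : Set where
  field
    sound  : All (λ (c , a) → length c ≡ l × a ≤ l) table
    covers : ∀ q → length q ≡ l → Any (λ (c , a) → Close k a c q) table

open IsTable

unitTable-isTable : ∀ k → IsTable k 1 unitTable
unitTable-isTable k .sound = (refl , z≤n) ∷ (refl , z≤n) ∷ []
unitTable-isTable k .covers (false ∷ []) _ = here (close refl ≤-refl (≤-reflexive (*-zeroʳ k)))
unitTable-isTable k .covers (true ∷ [])  _ = there (here (close refl ≤-refl (≤-trans (≤-reflexive (*-zeroʳ k)) z≤n)))

heavier-≤ : ∀ y z → weight y ≤ weight z → heavier y z ≡ z
heavier-≤ y z h rewrite m≤n⇒m∸n≡0 h = refl

heavier-> : ∀ y z → weight z < weight y → heavier y z ≡ y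
heavier-> y z h with weight y ∸ weight z | m<n⇒0<n∸m h
... | suc _ | _ = refl

-- `k ^ a` bounds the leaves of a local search of depth `a` that branches over at most `k` literals.
cost : ℕ → Table → ℕ
cost k table = sum (map (λ (c , a) → k ^ a) table)

-- The search: code, potential and invariant

module Search (k : ℕ) (1≤k : 1 ≤ k) (l′ : ℕ) (table : Table) (isTable : IsTable k (suc l′) table)
  -- `Θ m` majorises the total cost of all ways to fill `m` undetermined bits. Its two growth
  -- conditions match the two kinds of expansion, by a single bit when less than a block is left and
  -- by a whole block.
  (Θ : ℕ → ℕ) (Θ-pos : ∀ m → 1 ≤ Θ m) (Θ-unit : ∀ m → m < l′ → 2 * Θ m ≤ Θ (suc m))
  (Θ-table : ∀ m → cost k table * Θ m ≤ Θ (suc l′ + m)) where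

  State : Set
  State = List Bool × List Task

  advance : ∀ {n} → List Bool → CNF n → State → State
  advance r F (best , [])                  = best , []
  advance r F (best , (suc m , e , y) ∷ W) = best ,
    -- The difference is positive exactly if a whole block of `suc l′` bits is still undetermined.
    (if isCons (encodeℕ (suc m ∸ l′)) then expand (suc l′) table (suc m , e , y) W
                                      else expand 1 unitTable (suc m , e , y) W)
  advance r F (best , (zero , e , y) ∷ W) with findFalsified r y F | e
  ... | nothing | _     = heavier best y , W
  ... | just C  | zero  = best , W
  ... | just C  | suc e = best , children e y W C

  -- The register holds `env ∙ (best ∙ tasks)`, the first task having the form `m ∙ (e ∙ y)`;
  -- `W-path` is the list of the other tasks.
  best-path W-path m-path e-path y-path : Expr 2
  best-path = hd (tl x)
  W-path = tl (tl (tl x))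
  m-path = hd (hd (tl (tl x)))
  e-path = hd (tl (hd (tl (tl x))))
  y-path = tl (tl (hd (tl (tl x))))

  expand-code : Code
  expand-code = branch (tlsᵉ l′ m-path)
    (ret (cons (hd x) (cons best-path (expandᵉ (suc l′) table m-path e-path y-path W-path))))
    (ret (cons (hd x) (cons best-path (expandᵉ 1 unitTable m-path e-path y-path W-path))))

  falsified-code : Code
  falsified-code = branch (hd (tl (hd (tl (tl (hd x))))))
    (call (cons (cons (cons (tl (hd (tl (hd (tl (tl (hd x))))))) (tl (tl (hd (tl (tl (hd x)))))))
                      (tl (tl (tl (hd x)))))
                (tl (tl (tl x)))) children-code ++
     ret (cons (hd (hd (hd x))) (cons (hd (tl (hd (hd x)))) (tl (tl x)))))
    (ret (cons (hd (hd x)) (cons (hd (tl (hd x))) (tl (tl (tl (hd x)))))))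

  satisfied-code : Code
  satisfied-code =
    call (cons (hd (tl (hd x))) (tl (tl (hd (tl (tl (hd x))))))) heavier-code ++
    ret (cons (hd (hd (hd x))) (cons (tl x) (tl (tl (tl (hd (hd x)))))))

  inspect-code : Code
  inspect-code =
    call (cons (cons (cons (tl (hd x)) y-path) nil) (hd (hd x))) find-code ++
    branch (tl (tl x)) falsified-code satisfied-code

  body-code : Code
  body-code = branch m-path expand-code inspect-code

  children-total satisfied-total inspect-time : ℕ → ℕ
  children-total n  = 2 + (4 + children-time k n + 1)
  satisfied-total n = 1 + (4 + heavier-time n + 1)
  inspect-time n    = children-total n + satisfied-total n

  encodeState : State → Tree
  encodeState (best , W) = bits best ∙ encodeList encodeTask W

  module _ {n : ℕ} (r : List Bool) (F : CNF n) (kF : IsKCNF k F) where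

    env : Tree
    env = encodeList (encodeList encodeLiteral) F ∙ bits r

    step-time : ℕ
    step-time = 3 + ((4 + find-time k (length F) n) + inspect-time n)

    expand-↦ : ∀ best m e y W →
      expand-code ⊢ env ∙ encodeState (best , (suc m , e , y) ∷ W)
        ↦ env ∙ encodeState (advance r F (best , (suc m , e , y) ∷ W)) ⟨ 2 ⟩
    expand-↦ best m e y W with encodeℕ (suc m ∸ l′) in eq
    ... | nil   = branch-false
      (λ S → cong isCons (trans (eval-tlsᵉ l′ m-path _) (trans (tls-encodeℕ l′ (suc m)) eq)))
      (ret-↦ (λ S → refl))
    ... | _ ∙ _ = branch-true
      (λ S → cong isCons (trans (eval-tlsᵉ l′ m-path _) (trans (tls-encodeℕ l′ (suc m)) eq)))
      (ret-↦ (λ S → cong (λ t → env ∙ (bits best ∙ t))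
        (eval-expandᵉ (suc l′) table {m = suc m} {e} {y} {W} refl refl refl refl)))

    inspect-↦ : ∀ best e y W → length best ≤ n → length y ≡ n →
      inspect-code ⊢ env ∙ encodeState (best , (zero , e , y) ∷ W)
        ↦ env ∙ encodeState (advance r F (best , (zero , e , y) ∷ W))
        ⟨ (4 + find-time k (length F) n) + (1 + inspect-time n) ⟩
    inspect-↦ best e y W best≤n y≡n = seq (call-↦ (λ S → refl) (find-↦ r y F kF)) (rest e)
      where
      rest : ∀ e → branch (tl (tl x)) falsified-code satisfied-code ⊢
        (env ∙ encodeState (best , (zero , e , y) ∷ W)) ∙ ((bits r ∙ bits y) ∙ encodeMaybe (findFalsified r y F))
        ↦ env ∙ encodeState (advance r F (best , (zero , e , y) ∷ W)) ⟨ 1 + inspect-time n ⟩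
      rest e with findFalsified r y F in eq | e
      ... | nothing | _     = branch-false (λ S → refl) (weaken (≤-trans (n≤1+n _) (m≤n+m (satisfied-total n) (children-total n)))
        (seq (call-↦ (λ S → refl) (heavier-↦ best y best≤n (≤-reflexive y≡n))) (ret-↦ (λ S → refl))))
      ... | just C  | zero  = branch-true (λ S → refl) (weaken (s≤s (s≤s z≤n))
        (branch-false (λ S → refl) (ret-↦ (λ S → refl))))
      ... | just C  | suc e = branch-true (λ S → refl) (weaken (≤-trans (n≤1+n _) (m≤m+n (children-total n) (satisfied-total n)))
        (branch-true (λ S → refl) (seq (call-↦ (λ S → refl)
          (children-↦ e y W C (All.lookup kF (proj₁ (findFalsified-just r y F eq))) y≡n)) (ret-↦ (λ S → refl)))))

    body-↦ : ∀ best m e y W → length best ≤ n → m + length y ≡ n →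
      body-code ⊢ env ∙ encodeState (best , (m , e , y) ∷ W)
        ↦ env ∙ encodeState (advance r F (best , (m , e , y) ∷ W)) ⟨ step-time ⟩
    body-↦ best (suc m) e y W _      _   = weaken (s≤s (s≤s (s≤s z≤n))) (branch-true (λ S → refl) (expand-↦ best m e y W))
    body-↦ best zero    e y W best≤n y≡n = weaken
      (≤-trans (s≤s (≤-reflexive (+-suc (4 + find-time k (length F) n) (inspect-time n)))) (n≤1+n _))
      (branch-false (λ S → refl) (inspect-↦ best e y W best≤n y≡n))

  -- `k ^ e * Θ m` majorises the leaves below a task and the linear factor their remaining depth.
  -- Determining `l` bits lowers `2 * m` by `2 * l` and raises `e` by at most `l`, and a flip lowers
  -- `e` by 1, so the linear factor falls in either case.
  Φ : Task → ℕ
  Φ (m , e , y) = (2 * m + e + 1) * (k ^ e * Θ m)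

  Φs : List Task → ℕ
  Φs W = sum (map Φ W)

  k^e*Θ-pos : ∀ e m → 1 ≤ k ^ e * Θ m
  k^e*Θ-pos e m = *-mono-≤ (≤-trans (≤-reflexive (sym (^-zeroˡ e))) (^-monoˡ-≤ e 1≤k)) (Θ-pos m)

  expand-Φs-≤ : ∀ l tab m e y W → All (λ (c , a) → length c ≡ l × a ≤ l) tab →
    Φs (expand l tab (l + m , e , y) W) ≤ (2 * m + l + e + 1) * (k ^ e * (cost k tab * Θ m)) + Φs W
  expand-Φs-≤ l []              m e y W []             = m≤n+m (Φs W) _
  expand-Φs-≤ l ((c , a) ∷ tab) m e y W ((_ , a≤l) ∷ sound) = begin
    Φ (l + m ∸ l , a + e , c ++ y) + Φs (expand l tab (l + m , e , y) W)
      ≤⟨ +-mono-≤ entry (expand-Φs-≤ l tab m e y W sound) ⟩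
    b * (k ^ e * (k ^ a * Θ m)) + (b * (k ^ e * (cost k tab * Θ m)) + Φs W)
      ≡⟨ distrib b (k ^ e) (k ^ a) (cost k tab) (Θ m) (Φs W) ⟩
    b * (k ^ e * ((k ^ a + cost k tab) * Θ m)) + Φs W ∎
    where
    open ≤-Reasoning
    b : ℕ
    b = 2 * m + l + e + 1
    distrib : ∀ b q p c t w → b * (q * (p * t)) + (b * (q * (c * t)) + w) ≡ b * (q * ((p + c) * t)) + w
    distrib = solve-∀
    regroup : ∀ m a e → 2 * m + (a + e) + 1 ≡ 2 * m + a + e + 1
    regroup = solve-∀
    swap : ∀ p q t → p * q * t ≡ q * (p * t)
    swap = solve-∀
    entry : Φ (l + m ∸ l , a + e , c ++ y) ≤ b * (k ^ e * (k ^ a * Θ m))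
    entry rewrite m+n∸m≡n l m | ^-distribˡ-+-* k a e | regroup m a e | swap (k ^ a) (k ^ e) (Θ m) =
      *-monoˡ-≤ _ (+-monoˡ-≤ 1 (+-monoˡ-≤ e (+-monoʳ-≤ (2 * m) a≤l)))

  expand-Φs : ∀ l tab m e y W → 1 ≤ l → All (λ (c , a) → length c ≡ l × a ≤ l) tab →
    cost k tab * Θ m ≤ Θ (l + m) → Φs (expand l tab (l + m , e , y) W) < Φ (l + m , e , y) + Φs W
  expand-Φs l tab m e y W 1≤l sound cost≤ = begin
    suc (Φs (expand l tab (l + m , e , y) W))
      ≤⟨ s≤s (expand-Φs-≤ l tab m e y W sound) ⟩
    suc (b * (k ^ e * (cost k tab * Θ m)) + Φs W)
      ≤⟨ s≤s (+-monoˡ-≤ (Φs W) (*-monoʳ-≤ b (*-monoʳ-≤ (k ^ e) cost≤))) ⟩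
    1 + (b * (k ^ e * Θ (l + m)) + Φs W)
      -- The `l` units by which the linear factor falls pay for strictness.
      ≤⟨ +-monoˡ-≤ _ (*-mono-≤ 1≤l (k^e*Θ-pos e (l + m))) ⟩
    l * (k ^ e * Θ (l + m)) + (b * (k ^ e * Θ (l + m)) + Φs W)
      ≡⟨ collect l m e (k ^ e * Θ (l + m)) (Φs W) ⟩
    Φ (l + m , e , y) + Φs W ∎
    where
    open ≤-Reasoning
    b : ℕ
    b = 2 * m + l + e + 1
    collect : ∀ l m e q w → l * q + ((2 * m + l + e + 1) * q + w) ≡ (2 * (l + m) + e + 1) * q + w
    collect = solve-∀

  children-Φs : ∀ {n} e y W (C : Clause n) →
    Φs (children e y W C) ≡ length C * ((e + 1) * (k ^ e * Θ 0)) + Φs W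
  children-Φs e y W []      = refl
  children-Φs e y W (l ∷ C) = trans (children-Φs e y (children-step e y W l) C)
    (shift (length C) ((e + 1) * (k ^ e * Θ 0)) (Φs W))
    where
    shift : ∀ c q w → c * q + (q + w) ≡ (q + c * q) + w
    shift = solve-∀

  LeadsTo : List Bool → Task → Set
  LeadsTo z (m , e , y) = ∃[ p ] ∃[ q ] z ≡ p ++ q × length p ≡ m × Close k e y q

  -- The last `l` bits of the free prefix are covered by some entry of the table, and `close-++`
  -- joins them to the suffix.
  expand-leadsTo : ∀ {l tab m e y z} W → IsTable k l tab → LeadsTo z (l + m , e , y) →
    Any (LeadsTo z) (expand l tab (l + m , e , y) W)
  expand-leadsTo {l} {tab} {m} {e} {y} W isTab (p , q , refl , |p| , c-q) = go tab (covers isTab p₂ |p₂|)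
    where
    p₁ p₂ : List Bool
    p₁ = take m p
    p₂ = drop m p
    |p₁| : length p₁ ≡ m
    |p₁| = trans (List.length-take m p) (m≤n⇒m⊓n≡m (≤-trans (m≤n+m m l) (≤-reflexive (sym |p|))))
    |p₂| : length p₂ ≡ l
    |p₂| = trans (List.length-drop m p) (trans (cong (_∸ m) |p|) (m+n∸n≡m l m))
    z≡ : p ++ q ≡ p₁ ++ (p₂ ++ q)
    z≡ = trans (cong (_++ q) (sym (List.take++drop≡id m p))) (List.++-assoc p₁ p₂ q)
    go : ∀ tab → Any (λ (c , a) → Close k a c p₂) tab →
         Any (LeadsTo (p ++ q)) (foldr (λ (c , a) W → (l + m ∸ l , a + e , c ++ y) ∷ W) W tab)
    go _ (here c-p₂) = here (p₁ , p₂ ++ q , z≡ , trans |p₁| (sym (m+n∸m≡n l m)) , close-++ c-p₂ c-q)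
    go _ (there h)   = there (go _ h)

  expand-keeps : ∀ {P : Task → Set} l tab t {W} → Any P W → Any P (expand l tab t W)
  expand-keeps l []        t h = h
  expand-keeps l (_ ∷ tab) t h = there (expand-keeps l tab t h)

  children-keeps : ∀ {n} {P : Task → Set} {e y} (C : Clause n) {W} → Any P W → Any P (children e y W C)
  children-keeps []      h = h
  children-keeps (l ∷ C) h = children-keeps C (there h)

  children-new : ∀ {n} {P : Task → Set} {e y} {C : Clause n} {W} →
    Any (λ (i , _) → P (0 , e , flipAt (toℕ i) y)) C → Any P (children e y W C)
  children-new {C = l ∷ C} (here h)  = children-keeps C (here h)
  children-new {C = l ∷ C} (there h) = children-new {C = C} h

  -- Block and single-bit expansion are brought into one form, so that invariant and potential are
  -- treated once for both.
  expansion : ∀ {n} (r : List Bool) (F : CNF n) best m e y W →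
    ∃[ l ] ∃[ tab ] ∃[ m′ ] IsTable k l tab × 1 ≤ l × suc m ≡ l + m′ × cost k tab * Θ m′ ≤ Θ (l + m′) ×
      advance r F (best , (suc m , e , y) ∷ W) ≡ (best , expand l tab (suc m , e , y) W)
  expansion r F best m e y W with suc m ∸ l′ in eq
  ... | suc d = suc l′ , table , d , isTable , s≤s z≤n ,
    trans (sym (m+[n∸m]≡n {l′} {suc m} (<⇒≤ (m∸n≢0⇒n<m {suc m} {l′} (λ e → 0≢1+n (trans (sym e) eq)))))) (trans (cong (l′ +_) eq) (+-suc l′ d)) ,
    Θ-table d , refl
  ... | zero  = 1 , unitTable , m , unitTable-isTable k , ≤-refl , refl , Θ-unit m (m∸n≡0⇒m≤n eq) , refl

  module _ {n : ℕ} (r : List Bool) (F : CNF n) where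

    -- The inequality is `(k - 1) * weight z ≤ k * weight best` without subtraction.
    Good : List Bool → List Bool → Set
    Good z best = Sol r F best × length best ≡ n × k * weight z ≤ k * weight best + weight z

    good-mono : ∀ z best y → weight best ≤ weight y → Sol r F y → length y ≡ n → Good z best → Good z y
    good-mono z best y w≤ sol l (_ , _ , g) = sol , l , ≤-trans g (+-monoˡ-≤ _ (*-monoʳ-≤ k w≤))

    -- `[]` is the placeholder until a solution is met. Once the worklist is empty, `hit` leaves
    -- only `Good`, for all solutions `z` at once.
    record Invariant (st : State) : Set where
      constructor inv
      best = proj₁ st
      W    = proj₂ st
      field
        lengths : All (λ (m , e , y) → m + length y ≡ n) W
        best-ok : best ≡ [] ⊎ (Sol r F best × length best ≡ n)
        hit     : ∀ z → length z ≡ n → Sol r F z → Good z best ⊎ Any (LeadsTo z) W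

    open Invariant

    expand-lengths : ∀ l tab {m e y W} → All (λ (c , a) → length c ≡ l × a ≤ l) tab →
      l + m + length y ≡ n → All (λ (m , e , y) → m + length y ≡ n) W →
      All (λ (m , e , y) → m + length y ≡ n) (expand l tab (l + m , e , y) W)
    expand-lengths l []              []               h hW = hW
    expand-lengths l ((c , a) ∷ tab) {m} {e} {y} ((|c| , _) ∷ sound) h hW = new ∷ expand-lengths l tab sound h hW
      where
      new : l + m ∸ l + length (c ++ y) ≡ n
      new rewrite m+n∸m≡n l m | List.length-++ c {y} | |c| =
        trans (sym (+-assoc m l (length y))) (trans (cong (_+ length y) (+-comm m l)) h)

    children-lengths : ∀ {e y W} (C : Clause n) → length y ≡ n →
      All (λ (m , e , y) → m + length y ≡ n) W → All (λ (m , e , y) → m + length y ≡ n) (children e y W C)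
    children-lengths         []            h hW = hW
    children-lengths {y = y} ((i , b) ∷ C) h hW = children-lengths C h
      (trans (length-flipAt (toℕ i) y (≤-trans (toℕ<n i) (≤-reflexive (sym h)))) h ∷ hW)

    -- The literal that `z` satisfies is falsified at `y`, as is every literal of the clause, so the
    -- two offsets differ at its variable.
    disagreement : ∀ y z {C : Clause n} → All (λ l → falsifies r y l ≡ true) C →
      Any (λ (i , b) → bit r (toℕ i) xor bit z (toℕ i) ≡ b) C →
      Any (λ (i , b) → bit y (toℕ i) ≢ bit z (toℕ i)) C
    disagreement y z (f ∷ fs) (here h)  = here (λ e → xor-true _ _ f (trans (cong (bit r _ xor_) e) h))
    disagreement y z (f ∷ fs) (there h) = there (disagreement y z fs h)

    hit-solution : ∀ {e y z} → LeadsTo z (0 , e , y) → length y ≡ n → Sol r F y → Good z y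
    hit-solution {e} {y} ([] , z , refl , _ , c) |y| sol = sol , |y| , (begin
      k * weight z                     ≤⟨ *-monoʳ-≤ k (weight≤weight+up y z (Close.length-≡ c)) ⟩
      k * (weight y + up y z)          ≡⟨ *-distribˡ-+ k (weight y) (up y z) ⟩
      k * weight y + k * up y z        ≤⟨ +-monoʳ-≤ (k * weight y) (Close.up-≤ c) ⟩
      k * weight y + weight z          ∎)
      where open ≤-Reasoning

    -- A disagreement makes the distance positive, so the budget cannot be 0. The child that flips
    -- the disagreeing bit is one step closer to `z` and lacks no further ones.
    hit-children : ∀ {e y z C W} → LeadsTo z (0 , e , y) → length y ≡ n → All (λ l → falsifies r y l ≡ true) C →
      Any (λ (i , b) → bit r (toℕ i) xor bit z (toℕ i) ≡ b) C →
      ∃[ e′ ] e ≡ suc e′ × Any (LeadsTo z) (children e′ y W C)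
    hit-children {e} {y} {C = C} {W} ([] , z , refl , _ , c) |y| fs t = go e c
      where
      i<|y| : ∀ (i : Fin n) → toℕ i < length y
      i<|y| i = ≤-trans (toℕ<n i) (≤-reflexive (sym |y|))
      dis : Any (λ (i , b) → bit y (toℕ i) ≢ bit z (toℕ i)) C
      dis = disagreement y z fs t
      ham-eq : ∀ i → bit y (toℕ i) ≢ bit z (toℕ i) → suc (ham (flipAt (toℕ i) y) z) ≡ ham y z
      ham-eq i = ham-flipAt (toℕ i) y z (i<|y| i) (Close.length-≡ c)
      go : ∀ e → Close k e y z → ∃[ e′ ] e ≡ suc e′ × Any (LeadsTo z) (children e′ y W C)
      go zero    c′ = let ((i , _) , d) = Any.satisfied dis in
        contradiction (≤-trans (≤-reflexive (ham-eq i d)) (Close.ham-≤ c′)) (λ ())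
      go (suc e) c′ = e , refl , children-new (Any.map (λ {(i , _)} d →
        [] , z , refl , refl , close
          (trans (length-flipAt (toℕ i) y (i<|y| i)) (Close.length-≡ c))
          (≤-pred (≤-trans (≤-reflexive (ham-eq i d)) (Close.ham-≤ c′)))
          (≤-trans (*-monoʳ-≤ k (up-flipAt (toℕ i) y z (i<|y| i) (Close.length-≡ c) d)) (Close.up-≤ c)))
        dis)

    heavier-solution : ∀ best y → best ≡ [] ⊎ (Sol r F best × length best ≡ n) → Sol r F y → length y ≡ n →
      (Sol r F (heavier best y) × length (heavier best y) ≡ n) × weight best ≤ weight (heavier best y) × weight y ≤ weight (heavier best y)
    heavier-solution best y ok sol |y| with ≤-<-connex (weight best) (weight y)
    ... | inj₁ b≤y rewrite heavier-≤ best y b≤y = (sol , |y|) , b≤y , ≤-refl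
    ... | inj₂ y<b with ok
    ...   | inj₁ refl = contradiction y<b (λ ())
    ...   | inj₂ ok′ rewrite heavier-> best y y<b = ok′ , ≤-refl , <⇒≤ y<b

    expand-invariant : ∀ {l tab m m′ e y best W st} → IsTable k l tab → 1 ≤ l → m ≡ l + m′ →
      cost k tab * Θ m′ ≤ Θ (l + m′) → st ≡ (best , expand l tab (m , e , y) W) →
      Invariant (best , (m , e , y) ∷ W) → Invariant st × Φs (proj₂ st) < Φ (m , e , y) + Φs W
    expand-invariant {l} {tab} {m′ = m′} {e} {y} {W = W} isTab 1≤l refl cost≤ refl (inv (|y| ∷ ls) ok hit) =
      inv (expand-lengths l tab (sound isTab) |y| ls) ok
        (λ z |z| sol → Sum.map₂ (λ { (here h)  → expand-leadsTo W isTab h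
                                        ; (there h) → expand-keeps l tab _ h }) (hit z |z| sol)) ,
      expand-Φs l tab m′ e y W 1≤l (sound isTab) cost≤

    advance-invariant : IsKCNF k F → ∀ best t W → Invariant (best , t ∷ W) →
      Invariant (advance r F (best , t ∷ W)) × Φs (proj₂ (advance r F (best , t ∷ W))) < Φ t + Φs W
    advance-invariant kF best (suc m , e , y) W i =
      let (l , tab , m′ , isTab , 1≤l , m≡ , cost≤ , eq) = expansion r F best m e y W
      in expand-invariant isTab 1≤l m≡ cost≤ eq i
    advance-invariant kF best (zero , e , y) W (inv (|y| ∷ ls) ok hit) with findFalsified r y F in eq | e
    ... | nothing | e′ =
      let sol = findFalsified-nothing r y F eq
          (sol′ , |h|) , b≤ , y≤ = heavier-solution best y ok sol |y|
      in inv ls (inj₂ (sol′ , |h|)) (λ z |z| solz → go z sol sol′ |h| b≤ y≤ (hit z |z| solz)) ,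
         m<n+m (Φs W) (m<n⇒0<n (*-mono-≤ (m≤n+m 1 e′) (k^e*Θ-pos e′ 0)))
      where
      go : ∀ z → Sol r F y → Sol r F (heavier best y) → length (heavier best y) ≡ n →
           weight best ≤ weight (heavier best y) → weight y ≤ weight (heavier best y) →
           Good z best ⊎ Any (LeadsTo z) ((0 , e′ , y) ∷ W) → Good z (heavier best y) ⊎ Any (LeadsTo z) W
      go z sol sol′ |h| b≤ y≤ (inj₁ g)         = inj₁ (good-mono z best (heavier best y) b≤ sol′ |h| g)
      go z sol sol′ |h| b≤ y≤ (inj₂ (here h))  = inj₁ (good-mono z y (heavier best y) y≤ sol′ |h| (hit-solution h |y| sol))
      go z sol sol′ |h| b≤ y≤ (inj₂ (there h)) = inj₂ h
    ... | just C | zero =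
      inv ls ok (λ z |z| solz → go z solz (hit z |z| solz)) ,
      m<n+m (Φs W) (m<n⇒0<n (*-mono-≤ (s≤s (z≤n {0})) (k^e*Θ-pos 0 0)))
      where
      go : ∀ z → Sol r F z → Good z best ⊎ Any (LeadsTo z) ((0 , 0 , y) ∷ W) → Good z best ⊎ Any (LeadsTo z) W
      go z solz (inj₁ g)         = inj₁ g
      go z solz (inj₂ (there h)) = inj₂ h
      -- Discarding the task loses nothing: getting from a falsified clause to `z` takes a positive
      -- budget.
      go z solz (inj₂ (here h))  =
        let (C∈F , fs) = findFalsified-just r y F eq
            (_ , 0≡ , _) = hit-children {W = W} h |y| fs (All.lookup solz C∈F)
        in contradiction 0≡ 0≢1+n
    ... | just C | suc e′ =
      inv (children-lengths C |y| ls) ok (λ z |z| solz → go z solz (hit z |z| solz)) , decrease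
      where
      go : ∀ z → Sol r F z → Good z best ⊎ Any (LeadsTo z) ((0 , suc e′ , y) ∷ W) → Good z best ⊎ Any (LeadsTo z) (children e′ y W C)
      go z solz (inj₁ g)         = inj₁ g
      go z solz (inj₂ (there h)) = inj₂ (children-keeps C h)
      go z solz (inj₂ (here h))  with findFalsified-just r y F eq
      ... | C∈F , fs with hit-children {W = W} h |y| fs (All.lookup solz C∈F)
      ...   | _ , refl , h′ = inj₂ h′
      decrease : Φs (children e′ y W C) < Φ (0 , suc e′ , y) + Φs W
      decrease = begin
        suc (Φs (children e′ y W C))                              ≡⟨ cong suc (children-Φs e′ y W C) ⟩
        suc (length C * ((e′ + 1) * (k ^ e′ * Θ 0)) + Φs W)       ≤⟨ s≤s (+-monoˡ-≤ (Φs W) (*-monoˡ-≤ _ (All.lookup kF (proj₁ (findFalsified-just r y F eq))))) ⟩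
        -- The budget falls by one, which frees one unit `k ^ suc e′ * Θ 0`; being positive, it
        -- covers the 1.
        1 + (k * ((e′ + 1) * (k ^ e′ * Θ 0)) + Φs W)              ≤⟨ +-monoˡ-≤ _ (k^e*Θ-pos (suc e′) 0) ⟩
        k * k ^ e′ * Θ 0 + (k * ((e′ + 1) * (k ^ e′ * Θ 0)) + Φs W) ≡⟨ collect k e′ (k ^ e′) (Θ 0) (Φs W) ⟩
        Φ (0 , suc e′ , y) + Φs W                                 ∎
        where
        open ≤-Reasoning
        collect : ∀ k e p t w → k * p * t + (k * ((e + 1) * (p * t)) + w) ≡ (suc e + 1) * (k * p * t) + w
        collect = solve-∀

    loop-code : Code
    loop-code = loop (tl (tl x)) body-code

    best-length : ∀ {best} → best ≡ [] ⊎ (Sol r F best × length best ≡ n) → length best ≤ n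
    best-length (inj₁ refl)     = z≤n
    best-length (inj₂ (_ , eq)) = ≤-reflexive eq

    -- Recursion on a bound for the potential yields termination and the number of iterations
    -- together.
    loop-↦ : (kF : IsKCNF k F) → ∀ N best W → Φs W ≤ N → Invariant (best , W) →
      ∃[ best′ ] Invariant (best′ , []) ×
        loop-code ⊢ env r F kF ∙ encodeState (best , W) ↦ env r F kF ∙ encodeState (best′ , [])
          ⟨ N * suc (step-time r F kF) + 1 ⟩
    loop-↦ kF N best [] _ i = best , i , weaken (m≤n+m 1 _) (loop-exit (λ S → refl))
    loop-↦ kF N best ((m , e , y) ∷ W) Φ≤N i with advance-invariant kF best (m , e , y) W i
    ... | i′ , dec with N | ≤-trans dec Φ≤N
    ...   | suc N | s≤s Φ≤N′ with loop-↦ kF N _ _ Φ≤N′ i′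
    ...     | best′ , i″ , run = best′ , i″ , weaken (≤-reflexive (sym (+-assoc (suc (step-time r F kF)) _ 1)))
      (loop-enter (λ S → refl) (body-↦ r F kF best m e y W (best-length (best-ok i)) (All.head (lengths i))) run)

-- From offsets back to assignments

lookup-decode : ∀ n y (i : Fin n) → lookup (decode n (bits y)) i ≡ bit y (toℕ i)
lookup-decode (suc n) []      zero    = refl
lookup-decode (suc n) []      (suc i) = lookup-decode n [] i
lookup-decode (suc n) (b ∷ y) zero    = isCons-fromBool b
lookup-decode (suc n) (b ∷ y) (suc i) = lookup-decode n y i

bit-xorWith : ∀ r y i → i < length y → bit (xorWith r y) i ≡ bit r i xor bit y i
bit-xorWith r       (b ∷ y) zero    _       = refl
bit-xorWith []      (b ∷ y) (suc i) (s≤s l) = bit-xorWith [] y i l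
bit-xorWith (a ∷ r) (b ∷ y) (suc i) (s≤s l) = bit-xorWith r y i l

bit-toList : ∀ {n} (v : Vec Bool n) i → bit (toList v) (toℕ i) ≡ lookup v i
bit-toList (b ∷ v) zero    = refl
bit-toList (b ∷ v) (suc i) = bit-toList v i

d-H-decode-xorWith : ∀ r y → d-H (decode (length y) (bits r)) (decode (length y) (bits (xorWith r y))) ≡ weight y
d-H-decode-xorWith r           []          = refl
d-H-decode-xorWith []          (false ∷ y) = d-H-decode-xorWith [] y
d-H-decode-xorWith []          (true ∷ y)  = cong suc (d-H-decode-xorWith [] y)
d-H-decode-xorWith (false ∷ r) (false ∷ y) = d-H-decode-xorWith r y
d-H-decode-xorWith (false ∷ r) (true ∷ y)  = cong suc (d-H-decode-xorWith r y)
d-H-decode-xorWith (true ∷ r)  (false ∷ y) = d-H-decode-xorWith r y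
d-H-decode-xorWith (true ∷ r)  (true ∷ y)  = cong suc (d-H-decode-xorWith r y)

weight-toList : ∀ {n} (u v : Vec Bool n) → weight (toList (zipWith _xor_ u v)) ≡ d-H u v
weight-toList []          []          = refl
weight-toList (false ∷ u) (false ∷ v) = weight-toList u v
weight-toList (false ∷ u) (true ∷ v)  = cong suc (weight-toList u v)
weight-toList (true ∷ u)  (false ∷ v) = cong suc (weight-toList u v)
weight-toList (true ∷ u)  (true ∷ v)  = weight-toList u v

d-H-triangle : ∀ {n} (u v w : Vec Bool n) → d-H u w ≤ d-H v u + d-H v w
d-H-triangle []          []          []          = z≤n
d-H-triangle (false ∷ u) (false ∷ v) (false ∷ w) = d-H-triangle u v w
d-H-triangle (false ∷ u) (false ∷ v) (true ∷ w)  = ≤-trans (s≤s (d-H-triangle u v w)) (≤-reflexive (sym (+-suc (d-H v u) (d-H v w))))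
d-H-triangle (false ∷ u) (true ∷ v)  (false ∷ w) = ≤-trans (d-H-triangle u v w) (m≤n⇒m≤1+n (+-monoʳ-≤ (d-H v u) (n≤1+n _)))
d-H-triangle (false ∷ u) (true ∷ v)  (true ∷ w)  = s≤s (d-H-triangle u v w)
d-H-triangle (true ∷ u)  (false ∷ v) (false ∷ w) = s≤s (d-H-triangle u v w)
d-H-triangle (true ∷ u)  (false ∷ v) (true ∷ w)  = ≤-trans (d-H-triangle u v w) (m≤n⇒m≤1+n (+-monoʳ-≤ (d-H v u) (n≤1+n _)))
d-H-triangle (true ∷ u)  (true ∷ v)  (false ∷ w) = ≤-trans (s≤s (d-H-triangle u v w)) (≤-reflexive (sym (+-suc (d-H v u) (d-H v w))))
d-H-triangle (true ∷ u)  (true ∷ v)  (true ∷ w)  = d-H-triangle u v w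

module _ {n : ℕ} where

  offset : List Bool → Assignment n → List Bool
  offset r v = toList (zipWith _xor_ (decode n (bits r)) v)

  bit-offset : ∀ r v i → bit r (toℕ i) xor bit (offset r v) (toℕ i) ≡ lookup v i
  bit-offset r v i = begin
    b xor bit (offset r v) (toℕ i)                     ≡⟨ cong (b xor_) (bit-toList (zipWith _xor_ u v) i) ⟩
    b xor lookup (zipWith _xor_ u v) i                 ≡⟨ cong (b xor_) (Vec.lookup-zipWith _xor_ i u v) ⟩
    b xor (lookup u i xor lookup v i)                  ≡⟨ cong (λ a → b xor (a xor lookup v i)) (lookup-decode n r i) ⟩
    b xor (b xor lookup v i)                           ≡⟨ sym (xor-assoc b b (lookup v i)) ⟩
    (b xor b) xor lookup v i                           ≡⟨ cong (_xor lookup v i) (xor-same b) ⟩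
    lookup v i                                         ∎
    where
    open ≡-Reasoning
    b = bit r (toℕ i)
    u = decode n (bits r)

module _ {n : ℕ} {F : CNF n} where

  ⊨⇒Sol : ∀ r y v → (∀ i → bit r (toℕ i) xor bit y (toℕ i) ≡ lookup v i) → v ⊨ F → Sol r F y
  ⊨⇒Sol r y v h = All.map (Any.map (λ {(i , _)} e → trans (h i) e))

  Sol⇒⊨ : ∀ r y v → (∀ i → bit r (toℕ i) xor bit y (toℕ i) ≡ lookup v i) → Sol r F y → v ⊨ F
  Sol⇒⊨ r y v h = All.map (Any.map (λ {(i , _)} e → trans (sym (h i)) e))

  -- The maximum is either the default 0 or the distance of a pair of solutions, so a bound proved
  -- pair by pair passes to `Diam`.
  Diam-all : ∀ (P : ℕ → Set) → P 0 → (∀ u v → u ⊨ F → v ⊨ F → P (d-H u v)) → P (Diam F)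
  Diam-all P p0 h = argmax-all (λ x → x) p0 (All.tabulate λ {d} d∈ →
    let (u , v , u∈ , v∈ , eq) = ∈-cartesianProductWith⁻ d-H (Ω F) (Ω F) d∈
    in subst P (sym eq) (h u v (proj₂ (∈-filter⁻ (_⊨? F) {xs = cube n} u∈)) (proj₂ (∈-filter⁻ (_⊨? F) {xs = cube n} v∈))))

-- Rational arithmetic and probability

module _ where

  open import Data.Integer using (+_; -[1+_])

  toℚᵘ-/ : ∀ i d → toℚᵘ (i ℚ./ suc d) ℚᵘ.≃ mkℚᵘ i d
  toℚᵘ-/ i d = ℚ.toℚᵘ-fromℚᵘ (mkℚᵘ i d)

  ½[1-1/k]δ≤D : ∀ k .{{_ : NonZero k}} δ D → (k ∸ 1) * δ ≤ 2 * k * D →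
    ½ ℚ.* (1ℚ ℚ.- + 1 ℚ./ k) ℚ.* fromℕ δ ≤ℚ fromℕ D
  ½[1-1/k]δ≤D (suc k′) δ D h = ℚ.toℚᵘ-cancel-≤ (begin
    toℚᵘ (½ ℚ.* (1ℚ ℚ.- 1/k) ℚ.* fromℕ δ)               ≃⟨ ℚ.toℚᵘ-homo-* (½ ℚ.* (1ℚ ℚ.- 1/k)) (fromℕ δ) ⟩
    toℚᵘ (½ ℚ.* (1ℚ ℚ.- 1/k)) ℚᵘ.* toℚᵘ (fromℕ δ)       ≃⟨ ℚᵘ.*-cong (ℚ.toℚᵘ-homo-* ½ (1ℚ ℚ.- 1/k)) (toℚᵘ-/ (+ δ) 0) ⟩
    toℚᵘ ½ ℚᵘ.* toℚᵘ (1ℚ ℚ.- 1/k) ℚᵘ.* mkℚᵘ (+ δ) 0     ≃⟨ ℚᵘ.*-congʳ {mkℚᵘ (+ δ) 0} (ℚᵘ.*-congˡ {toℚᵘ ½} difference) ⟩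
    toℚᵘ ½ ℚᵘ.* mkℚᵘ (+ k′) k′ ℚᵘ.* mkℚᵘ (+ δ) 0        ≤⟨ *≤* integers ⟩
    mkℚᵘ (+ D) 0                                        ≃⟨ ℚᵘ.≃-sym (toℚᵘ-/ (+ D) 0) ⟩
    toℚᵘ (fromℕ D)                                      ∎)
    where
    open ℚᵘ.≤-Reasoning
    1/k : ℚ
    1/k = + 1 ℚ./ suc k′
    ring : ∀ x → (+ 1 ℤ.* (+ 1 ℤ.+ x) ℤ.+ -[1+ 0 ] ℤ.* + 1) ℤ.* (+ 1 ℤ.+ x) ≡ x ℤ.* (+ 1 ℤ.* (+ 1 ℤ.+ x))
    ring = ℤ-Solver.solve-∀
    difference : toℚᵘ (1ℚ ℚ.- 1/k) ℚᵘ.≃ mkℚᵘ (+ k′) k′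
    difference =
      ℚᵘ.≃-trans (ℚ.toℚᵘ-homo-+ 1ℚ (ℚ.- 1/k))
      (ℚᵘ.≃-trans (ℚᵘ.+-congʳ (toℚᵘ 1ℚ) (ℚᵘ.≃-trans (ℚ.toℚᵘ-homo‿- 1/k) (ℚᵘ.-‿cong (toℚᵘ-/ (+ 1) k′))))
      (*≡* (ring (+ k′))))
    numerator : + (k′ * δ) ≡ + 1 ℤ.* + k′ ℤ.* + δ ℤ.* + 1
    numerator = trans (ℤ.pos-* k′ δ) (sym (trans (ℤ.*-identityʳ _) (cong (ℤ._* + δ) (ℤ.*-identityˡ (+ k′)))))
    denominator : 2 * suc k′ * D ≡ D * (2 * suc k′ * 1)
    denominator = reorder D (suc k′)
      where
      reorder : ∀ d k → 2 * k * d ≡ d * (2 * k * 1)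
      reorder = solve-∀
    integers : + 1 ℤ.* + k′ ℤ.* + δ ℤ.* + 1 ℤ.≤ + D ℤ.* + (2 * suc k′ * 1)
    integers = subst₂ ℤ._≤_ numerator (trans (cong +_ denominator) (ℤ.pos-* D _)) (ℤ.+≤+ h)

  +n/n≡1ℚ : ∀ n .{{_ : NonZero n}} → + n ℚ./ n ≡ 1ℚ
  +n/n≡1ℚ (suc n) = ℚ.toℚᵘ-injective (ℚᵘ.≃-trans (toℚᵘ-/ (+ suc n) n) (*≡* (trans (ℤ.*-identityʳ (+ suc n)) (sym (ℤ.*-identityˡ (+ suc n))))))

  length-cube : ∀ t → length (cube t) ≡ 2 ^ t
  length-cube zero    = refl
  length-cube (suc t) = trans (List.length-++ (map (false ∷_) (cube t)))
    (cong₂ _+_ (trans (List.length-map _ (cube t)) (length-cube t))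
               (trans (List.length-map _ (cube t)) (trans (length-cube t) (sym (+-identityʳ _)))))

  Pr-certain : ∀ {t} {E : Vec Bool t → Set} (E? : Decidable E) → (∀ ω → E ω) → Pr E? ≡ 1ℚ
  Pr-certain {t} E? certain = trans
    (cong (λ m → ℚ._/_ (+ m) (2 ^ t) {{m^n≢0 2 t}})
      (trans (cong length (List.filter-all E? (All.universal certain (cube t)))) (length-cube t)))
    (+n/n≡1ℚ (2 ^ t) {{m^n≢0 2 t}})

-- Halting and success from a deterministic run

run-↦ : ∀ {p input u m t} → m ≤ t → p ⊢ input ↦ u ⟨ m ⟩ →
  (ω : Vec Bool t) → run ω (start (1 , p) input) ≡ ([] , u ∷ nil ∷ [])
run-↦ {p} {input} {u} {m} m≤t h = ⇒-halts (⇒-weaken m≤t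
  (subst (λ p → (p , input ∷ nil ∷ []) ⇒⟨ m ⟩ ([] , u ∷ nil ∷ [])) (List.++-identityʳ p) (h ._⊢_↦_⟨_⟩.exec nil [])))

success-certain : ∀ k .{{_ : NonZero k}} P {n} (F : CNF n) t →
  ((ω : Vec Bool t) → Dispersed k F (decodePair n (output P (encode F) ω))) → successProbability k P F t ≡ 1ℚ
success-certain k P {n} F t = Pr-certain {t} {λ ω → Dispersed k F (decodePair n (output P (encode F) ω))}
  (λ ω → dispersed? k F (decodePair n (output P (encode F) ω)))

Dispersed-intro : ∀ k .{{_ : NonZero k}} {n} (F : CNF n) z₁ z₂ → z₁ ⊨ F → z₂ ⊨ F →
  (k ∸ 1) * Diam F ≤ 2 * k * d-H z₁ z₂ → Dispersed k F (z₁ , z₂)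
Dispersed-intro k F z₁ z₂ z₁⊨F z₂⊨F far = z₁⊨F , z₂⊨F , ½[1-1/k]δ≤D k (Diam F) (d-H z₁ z₂) far

Dispersed-resp-≡ : ∀ k .{{_ : NonZero k}} {n} (F : CNF n) u v → u ≡ v →
  Dispersed k F (decodePair n v) → Dispersed k F (decodePair n u)
Dispersed-resp-≡ k F u .u refl d = d

halts×succeeds : ∀ k .{{_ : NonZero k}} {n} p m t (F : CNF n) → m ≤ t →
  ∃[ u ] p ⊢ encode F ↦ u ⟨ m ⟩ ×
    (Satisfiable F → let (z₁ , z₂) = decodePair n u in z₁ ⊨ F × z₂ ⊨ F × (k ∸ 1) * Diam F ≤ 2 * k * d-H z₁ z₂) →
  HaltsWithin (1 , p) (encode F) t × (Satisfiable F → successProbability k (1 , p) F t ≡ 1ℚ)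
halts×succeeds k {n} p m t F m≤t (u , h , correct) = (λ ω → cong proj₁ (halted ω)) , success
  where
  halted : (ω : Vec Bool t) → run ω (start (1 , p) (encode F)) ≡ ([] , u ∷ nil ∷ [])
  halted = run-↦ m≤t h
  success : Satisfiable F → successProbability k (1 , p) F t ≡ 1ℚ
  success sat = let (z₁⊨F , z₂⊨F , far) = correct sat in
    success-certain k (1 , p) F t (λ ω →
      Dispersed-resp-≡ k F (output (1 , p) (encode F) ω) u (cong (λ c → lookup (proj₂ c) zero) (halted ω))
        (Dispersed-intro k F (decode n (hdᵗ u)) (decode n (tlᵗ u)) z₁⊨F z₂⊨F far))

1-ε≤1 : ∀ ε → 0ℚ <ℚ ε → 1ℚ -ℚ ε ≤ℚ 1ℚ
1-ε≤1 ε 0<ε = ℚ.≤-trans (ℚ.+-monoʳ-≤ 1ℚ (ℚ.neg-antimono-≤ (ℚ.<⇒≤ 0<ε))) (ℚ.≤-reflexive (ℚ.+-identityʳ 1ℚ))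

open ≤-Reasoning

-- Greedy covering of the cube by weighted balls

module _ {A : Set} where

  ∑ : List A → (A → ℕ) → ℕ
  ∑ xs f = sum (map f xs)

  ∑-cong : ∀ xs {f g : A → ℕ} → (∀ a → f a ≡ g a) → ∑ xs f ≡ ∑ xs g
  ∑-cong xs h = cong sum (List.map-cong h xs)

  ∑-mono : ∀ xs {f g : A → ℕ} → (∀ a → a ∈ xs → f a ≤ g a) → ∑ xs f ≤ ∑ xs g
  ∑-mono []       h = z≤n
  ∑-mono (a ∷ xs) h = +-mono-≤ (h a (here refl)) (∑-mono xs (λ a → h a ∘ there))

  ∑-+ : ∀ xs (f g : A → ℕ) → ∑ xs (λ a → f a + g a) ≡ ∑ xs f + ∑ xs g
  ∑-+ []       f g = refl
  ∑-+ (a ∷ xs) f g = trans (cong (f a + g a +_) (∑-+ xs f g)) (interchange (f a) (g a) (∑ xs f) (∑ xs g))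
    where
    interchange : ∀ a b c d → a + b + (c + d) ≡ a + c + (b + d)
    interchange = solve-∀

  ∑-* : ∀ xs m (f : A → ℕ) → ∑ xs (λ a → m * f a) ≡ m * ∑ xs f
  ∑-* []       m f = sym (*-zeroʳ m)
  ∑-* (a ∷ xs) m f = trans (cong (m * f a +_) (∑-* xs m f)) (sym (*-distribˡ-+ m (f a) (∑ xs f)))

  ∑-++ : ∀ xs ys (f : A → ℕ) → ∑ (xs ++ ys) f ≡ ∑ xs f + ∑ ys f
  ∑-++ xs ys f = trans (cong sum (List.map-++ f xs ys)) (sum-++ (map f xs) (map f ys))

  ∑-∈ : ∀ {xs a} (f : A → ℕ) → a ∈ xs → f a ≤ ∑ xs f
  ∑-∈ f (here refl) = m≤m+n _ _
  ∑-∈ f (there a∈)  = ≤-trans (∑-∈ f a∈) (m≤n+m _ _)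

  ∑-≤-length*max : ∀ xs (f : A → ℕ) → 1 ≤ length xs → ∃[ a ] a ∈ xs × ∑ xs f ≤ length xs * f a
  ∑-≤-length*max (a ∷ [])     f _ = a , here refl , ≤-refl
  ∑-≤-length*max (a ∷ b ∷ xs) f _ with ∑-≤-length*max (b ∷ xs) f (s≤s z≤n)
  ... | c , c∈ , h with ≤-total (f a) (f c)
  ...   | inj₁ a≤c = c , there c∈ , +-mono-≤ a≤c h
  ...   | inj₂ c≤a = a , here refl , +-monoʳ-≤ (f a) (≤-trans h (*-monoʳ-≤ (suc (length xs)) c≤a))

∑-map : ∀ {A B : Set} (g : A → B) xs (f : B → ℕ) → ∑ (map g xs) f ≡ ∑ xs (f ∘ g)
∑-map g xs f = cong sum (sym (List.map-∘ xs))

∑-swap : ∀ {A B : Set} (xs : List A) (ys : List B) (f : A → B → ℕ) →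
  ∑ xs (λ a → ∑ ys (f a)) ≡ ∑ ys (λ b → ∑ xs (λ a → f a b))
∑-swap []       ys f = sym (zeros ys)
  where
  zeros : ∀ {B : Set} (ys : List B) → ∑ ys (λ _ → 0) ≡ 0
  zeros []       = refl
  zeros (_ ∷ ys) = zeros ys
∑-swap (a ∷ xs) ys f = trans (cong (∑ ys (f a) +_) (∑-swap xs ys f)) (sym (∑-+ ys (f a) (λ b → ∑ xs (λ a → f a b))))

∑-const : ∀ {A : Set} (xs : List A) m → ∑ xs (λ _ → m) ≡ length xs * m
∑-const []       m = refl
∑-const (_ ∷ xs) m = cong (m +_) (∑-const xs m)

∑-cartesianProduct : ∀ {A B : Set} (xs : List A) (ys : List B) (f : A × B → ℕ) →
  ∑ (cartesianProduct xs ys) f ≡ ∑ xs (λ a → ∑ ys (λ b → f (a , b)))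
∑-cartesianProduct []       ys f = refl
∑-cartesianProduct (a ∷ xs) ys f = trans (∑-++ (map (a ,_) ys) (cartesianProduct xs ys) f)
  (cong₂ _+_ (∑-map (a ,_) ys f) (∑-cartesianProduct xs ys f))

length-cartesianProduct : ∀ {A B : Set} (xs : List A) (ys : List B) → length (cartesianProduct xs ys) ≡ length xs * length ys
length-cartesianProduct []       ys = refl
length-cartesianProduct (a ∷ xs) ys = trans (List.length-++ (map (a ,_) ys))
  (cong₂ _+_ (List.length-map (a ,_) ys) (length-cartesianProduct xs ys))

-- Words and biased bit flips

words : ℕ → List (List Bool)
words zero    = [] ∷ []
words (suc n) = map (false ∷_) (words n) ++ map (true ∷_) (words n)

∑-words : ∀ n (f : List Bool → ℕ) →
  ∑ (words (suc n)) f ≡ ∑ (words n) (f ∘ (false ∷_)) + ∑ (words n) (f ∘ (true ∷_))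
∑-words n f = trans (∑-++ (map (false ∷_) (words n)) (map (true ∷_) (words n)) f)
  (cong₂ _+_ (∑-map (false ∷_) (words n) f) (∑-map (true ∷_) (words n) f))

length-words : ∀ n → length (words n) ≡ 2 ^ n
length-words zero    = refl
length-words (suc n) = trans (List.length-++ (map (false ∷_) (words n)))
  (cong₂ _+_ (trans (List.length-map _ (words n)) (length-words n))
             (trans (List.length-map _ (words n)) (trans (length-words n) (sym (+-identityʳ _)))))

∈-words⁺ : ∀ q → q ∈ words (length q)
∈-words⁺ []          = here refl
∈-words⁺ (false ∷ q) = ∈-++⁺ˡ (∈-map⁺ (false ∷_) (∈-words⁺ q))
∈-words⁺ (true ∷ q)  = ∈-++⁺ʳ (map (false ∷_) (words (length q))) (∈-map⁺ (true ∷_) (∈-words⁺ q))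

∈-words⁻ : ∀ n {q} → q ∈ words n → length q ≡ n
∈-words⁻ zero    (here refl) = refl
∈-words⁻ (suc n) q∈ with ∈-++⁻ (map (false ∷_) (words n)) q∈
... | inj₁ q∈′ with (_ , c∈ , refl) ← ∈-map⁻ (false ∷_) q∈′ = cong suc (∈-words⁻ n c∈)
... | inj₂ q∈′ with (_ , c∈ , refl) ← ∈-map⁻ (true ∷_) q∈′ = cong suc (∈-words⁻ n c∈)

ham≤length : ∀ c q → ham c q ≤ length q
ham≤length []          q           = z≤n
ham≤length (false ∷ c) []          = z≤n
ham≤length (true ∷ c)  []          = z≤n
ham≤length (false ∷ c) (false ∷ q) = m≤n⇒m≤1+n (ham≤length c q)
ham≤length (false ∷ c) (true ∷ q)  = s≤s (ham≤length c q)
ham≤length (true ∷ c)  (false ∷ q) = s≤s (ham≤length c q)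
ham≤length (true ∷ c)  (true ∷ q)  = m≤n⇒m≤1+n (ham≤length c q)

module _ (k : ℕ) where

  -- (k + 1)^n times the probability of c when every bit of q is flipped
  -- independently with probability 1/(k + 1).
  likelihood : List Bool → List Bool → ℕ
  likelihood (false ∷ c) (false ∷ q) = k * likelihood c q
  likelihood (true ∷ c)  (true ∷ q)  = k * likelihood c q
  likelihood (_ ∷ c)     (_ ∷ q)     = likelihood c q
  likelihood _           _           = 1

  likelihood-ham : ∀ c q → length c ≡ length q → likelihood c q ≡ k ^ (length q ∸ ham c q)
  likelihood-ham []          []          _ = refl
  likelihood-ham (false ∷ c) (false ∷ q) e = trans (cong (k *_) (likelihood-ham c q (suc-injective e)))
    (cong (k ^_) (sym (+-∸-assoc 1 (ham≤length c q))))
  likelihood-ham (false ∷ c) (true ∷ q)  e = likelihood-ham c q (suc-injective e)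
  likelihood-ham (true ∷ c)  (false ∷ q) e = likelihood-ham c q (suc-injective e)
  likelihood-ham (true ∷ c)  (true ∷ q)  e = trans (cong (k *_) (likelihood-ham c q (suc-injective e)))
    (cong (k ^_) (sym (+-∸-assoc 1 (ham≤length c q))))

  ∑-likelihood : ∀ q → ∑ (words (length q)) (λ c → likelihood c q) ≡ (k + 1) ^ length q
  ∑-likelihood []      = refl
  ∑-likelihood (b ∷ q) = trans (∑-words (length q) (λ c → likelihood c (b ∷ q))) (go b)
    where
    S : ℕ
    S = ∑ (words (length q)) (λ c → likelihood c q)
    kS : ∑ (words (length q)) (λ c → k * likelihood c q) ≡ k * S
    kS = ∑-* (words (length q)) k (λ c → likelihood c q)
    ring₁ : ∀ k t → k * t + t ≡ (k + 1) * t
    ring₁ = solve-∀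
    go : ∀ b → ∑ (words (length q)) (λ c → likelihood (false ∷ c) (b ∷ q)) + ∑ (words (length q)) (λ c → likelihood (true ∷ c) (b ∷ q))
             ≡ (k + 1) * (k + 1) ^ length q
    go false = trans (cong (_+ S) kS) (trans (ring₁ k S) (cong ((k + 1) *_) (∑-likelihood q)))
    go true  = trans (cong (S +_) kS) (trans (trans (+-comm S (k * S)) (ring₁ k S)) (cong ((k + 1) *_) (∑-likelihood q)))

  -- Linearity of expectation, one bit at a time: only a one of `q` contributes, and it is lost with
  -- probability `1 / (k + 1)`.
  ∑-up-likelihood : ∀ q → (k + 1) * ∑ (words (length q)) (λ c → up c q * likelihood c q) ≡ weight q * (k + 1) ^ length q
  ∑-up-likelihood []          = *-zeroʳ (k + 1)
  ∑-up-likelihood (false ∷ q) = begin-equality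
    (k + 1) * ∑ (words (suc n)) (λ c → up c (false ∷ q) * likelihood c (false ∷ q))
      ≡⟨ cong ((k + 1) *_) (∑-words n (λ c → up c (false ∷ q) * likelihood c (false ∷ q))) ⟩
    (k + 1) * (∑ (words n) (λ c → up c q * (k * likelihood c q)) + U)
      ≡⟨ cong (λ s → (k + 1) * (s + U)) (trans (∑-cong (words n) (λ c → swap (up c q) k (likelihood c q))) (∑-* (words n) k _)) ⟩
    (k + 1) * (k * U + U)                 ≡⟨ ring k U ⟩
    (k + 1) * ((k + 1) * U)               ≡⟨ cong ((k + 1) *_) (∑-up-likelihood q) ⟩
    (k + 1) * (weight q * (k + 1) ^ n)    ≡⟨ swap (k + 1) (weight q) ((k + 1) ^ n) ⟩
    weight q * ((k + 1) * (k + 1) ^ n)    ∎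
    where
    n = length q
    U = ∑ (words n) (λ c → up c q * likelihood c q)
    swap : ∀ a b c → a * (b * c) ≡ b * (a * c)
    swap = solve-∀
    ring : ∀ k u → (k + 1) * (k * u + u) ≡ (k + 1) * ((k + 1) * u)
    ring = solve-∀
  ∑-up-likelihood (true ∷ q) = begin-equality
    (k + 1) * ∑ (words (suc n)) (λ c → up c (true ∷ q) * likelihood c (true ∷ q))
      ≡⟨ cong ((k + 1) *_) (∑-words n (λ c → up c (true ∷ q) * likelihood c (true ∷ q))) ⟩
    (k + 1) * (∑ (words n) (λ c → likelihood c q + up c q * likelihood c q) + ∑ (words n) (λ c → up c q * (k * likelihood c q)))
      ≡⟨ cong₂ (λ s t → (k + 1) * (s + t)) (∑-+ (words n) (λ c → likelihood c q) (λ c → up c q * likelihood c q))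
           (trans (∑-cong (words n) (λ c → swap (up c q) k (likelihood c q))) (∑-* (words n) k _)) ⟩
    (k + 1) * ((L + U) + k * U)                        ≡⟨ ring k L U ⟩
    (k + 1) * (L + (k + 1) * U)                        ≡⟨ cong₂ (λ s t → (k + 1) * (s + t)) (∑-likelihood q) (∑-up-likelihood q) ⟩
    (k + 1) * ((k + 1) ^ n + weight q * (k + 1) ^ n)   ≡⟨ swap (k + 1) (suc (weight q)) ((k + 1) ^ n) ⟩
    suc (weight q) * ((k + 1) * (k + 1) ^ n)           ∎
    where
    n = length q
    L = ∑ (words n) (λ c → likelihood c q)
    U = ∑ (words n) (λ c → up c q * likelihood c q)
    swap : ∀ a b c → a * (b * c) ≡ b * (a * c)
    swap = solve-∀
    ring : ∀ k l u → (k + 1) * ((l + u) + k * u) ≡ (k + 1) * (l + (k + 1) * u)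
    ring = solve-∀

  light? : ∀ c q → Dec (k * up c q ≤ weight q)
  light? c q = k * up c q ≤? weight q

  lightLikelihood : List Bool → List Bool → ℕ
  lightLikelihood q c with light? c q
  ... | yes _ = likelihood c q
  ... | no  _ = 0

  lightLikelihood-cases : ∀ q c →
    (k * up c q ≤ weight q × lightLikelihood q c ≡ likelihood c q) ⊎ lightLikelihood q c ≡ 0
  lightLikelihood-cases q c with light? c q
  ... | yes l = inj₁ (l , refl)
  ... | no  _ = inj₂ refl

  up≤weight : ∀ c q → up c q ≤ weight q
  up≤weight []          q           = z≤n
  up≤weight (false ∷ c) []          = z≤n
  up≤weight (true ∷ c)  []          = z≤n
  up≤weight (false ∷ c) (false ∷ q) = up≤weight c q
  up≤weight (false ∷ c) (true ∷ q)  = s≤s (up≤weight c q)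
  up≤weight (true ∷ c)  (false ∷ q) = up≤weight c q
  up≤weight (true ∷ c)  (true ∷ q)  = m≤n⇒m≤1+n (up≤weight c q)

  -- Markov's inequality: the expected number of ones flipped to zero is
  -- weight q / (k + 1).
  ∑-lightLikelihood : ∀ q → (k + 1) ^ length q ≤ (k + 1) * ∑ (words (length q)) (lightLikelihood q)
  ∑-lightLikelihood q = go (weight q) refl
   where
   go : ∀ w → weight q ≡ w → (k + 1) ^ length q ≤ (k + 1) * ∑ (words (length q)) (lightLikelihood q)
   -- Markov's inequality would divide by the weight. At weight 0 there is nothing to lose and every
   -- `c` is light.
   go zero eq = begin
     (k + 1) ^ length q                             ≡⟨ sym (∑-likelihood q) ⟩
     ∑ (words (length q)) (λ c → likelihood c q)    ≤⟨ ∑-mono (words (length q)) (λ c _ → always c) ⟩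
     G                                              ≤⟨ m≤n*m G (k + 1) {{>-nonZero (m≤n+m 1 k)}} ⟩
     (k + 1) * G                                    ∎
     where
     G = ∑ (words (length q)) (lightLikelihood q)
     always : ∀ c → likelihood c q ≤ lightLikelihood q c
     always c with light? c q
     ... | yes _ = ≤-refl
     ... | no ¬l = contradiction (≤-trans (*-monoʳ-≤ k (up≤weight c q)) (≤-trans (≤-reflexive (trans (cong (k *_) eq) (*-zeroʳ k))) z≤n)) ¬l
   go (suc w) eq = *-cancelˡ-≤ (suc w) (+-cancelʳ-≤ (k * (suc w * P)) (suc w * P) (suc w * ((k + 1) * G)) (begin
     suc w * P + k * (suc w * P)              ≡⟨ ring₁ k (suc w) P ⟩
     (k + 1) * (suc w * P)                    ≡⟨ cong (λ s → (k + 1) * (suc w * s)) (sym (∑-likelihood q)) ⟩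
     (k + 1) * (suc w * ∑ W (λ c → likelihood c q))
       ≡⟨ cong ((k + 1) *_) (sym (∑-* W (suc w) (λ c → likelihood c q))) ⟩
     (k + 1) * ∑ W (λ c → suc w * likelihood c q)
       ≤⟨ *-monoʳ-≤ (k + 1) (∑-mono W (λ c _ → markov c)) ⟩
     (k + 1) * ∑ W (λ c → suc w * lightLikelihood q c + k * (up c q * likelihood c q))
       ≡⟨ cong ((k + 1) *_) (trans (∑-+ W (λ c → suc w * lightLikelihood q c) _)
            (cong₂ _+_ (∑-* W (suc w) (lightLikelihood q)) (∑-* W k (λ c → up c q * likelihood c q)))) ⟩
     (k + 1) * (suc w * G + k * U)            ≡⟨ ring₂ k (suc w) G U ⟩
     suc w * ((k + 1) * G) + k * ((k + 1) * U)
       ≡⟨ cong (λ s → suc w * ((k + 1) * G) + k * s) (trans (∑-up-likelihood q) (cong (_* P) eq)) ⟩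
     suc w * ((k + 1) * G) + k * (suc w * P)  ∎))
     where
     W = words (length q)
     P = (k + 1) ^ length q
     G = ∑ W (lightLikelihood q)
     U = ∑ W (λ c → up c q * likelihood c q)
     ring₁ : ∀ k w p → w * p + k * (w * p) ≡ (k + 1) * (w * p)
     ring₁ = solve-∀
     ring₂ : ∀ k w g u → (k + 1) * (w * g + k * u) ≡ w * ((k + 1) * g) + k * ((k + 1) * u)
     ring₂ = solve-∀
     -- The pointwise form: a `c` that is not light has `suc w < k * up c q`, so the second summand
     -- alone suffices.
     markov : ∀ c → suc w * likelihood c q ≤ suc w * lightLikelihood q c + k * (up c q * likelihood c q)
     markov c with light? c q
     ... | yes _ = m≤m+n _ _
     ... | no ¬l = ≤-trans (*-monoˡ-≤ (likelihood c q) (≤-trans (≤-reflexive (sym eq)) (<⇒≤ (≰⇒> ¬l))))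
       (≤-trans (≤-reflexive (*-assoc k (up c q) (likelihood c q))) (m≤n+m _ (suc w * 0)))

-- Weighted set cover

module SetCover {E Q : Set} {R : E → Q → Set} (R? : ∀ e q → Dec (R e q)) where

  ι : E → Q → ℕ
  ι e q with R? e q
  ... | yes _ = 1
  ... | no  _ = 0

  ι-yes : ∀ {e q} → R e q → ι e q ≡ 1
  ι-yes {e} {q} h with R? e q
  ... | yes _ = refl
  ... | no ¬h = contradiction h ¬h

  uncovered : E → List Q → List Q
  uncovered e = filter (¬? ∘ R? e)

  length-uncovered : ∀ e U → length U ≡ ∑ U (ι e) + length (uncovered e U)
  length-uncovered e []      = refl
  length-uncovered e (q ∷ U) with R? e q
  ... | yes _ = cong suc (length-uncovered e U)
  ... | no  _ = trans (cong suc (length-uncovered e U)) (sym (+-suc (∑ U (ι e)) _))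

  Covered : List E → Q → Set
  Covered S q = Any (λ e → R e q) S

  module Greedy {P : Q → Set} {V : E → Set} (price : E → ℕ) (price-pos : ∀ e → V e → 1 ≤ price e)
    (A D : ℕ) (1≤A : 1 ≤ A)
    -- Some set pays at most `D / (A * length U)` per newly covered element. In the application
    -- `D / A` is the cost of a fractional cover.
    (pick : ∀ U → All P U → ∃[ e ] V e × A * (length U * price e) ≤ D * ∑ U (ι e)) where

    -- As long as at least h elements are uncovered, each new set pays at most
    -- D / (A h) for every element that it covers.
    phase : ∀ h fuel U → length U ≤ fuel → All P U → 1 ≤ h →
      ∃[ S ] ∃[ U′ ] All V S × length U′ < h × All P U′ ×
        (∀ q → q ∈ U → Covered S q ⊎ q ∈ U′) × A * (h * ∑ S price) + D * length U′ ≤ D * length U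
    phase h fuel U U≤ PU 1≤h with length U <? h
    phase h fuel U U≤ PU 1≤h | yes U<h = [] , U , [] , U<h , PU , (λ q → inj₂) ,
      ≤-reflexive (cong (_+ D * length U) (trans (cong (A *_) (*-zeroʳ h)) (*-zeroʳ A)))
    phase h zero U U≤ PU 1≤h | no U≮h = contradiction (≤-trans (s≤s U≤) 1≤h) U≮h
    phase h (suc fuel) U U≤ PU 1≤h | no U≮h with pick U PU
    ... | e , Ve , gain with phase h fuel (uncovered e U) smaller (All.filter⁺ (¬? ∘ R? e) PU) 1≤h
      where
      -- The left side is positive, so a picked set covers something new; this is why fuel
      -- `length U` suffices.
      positive : ∀ g → A * (length U * price e) ≤ D * g → 1 ≤ g
      positive (suc _) _ = s≤s z≤n
      positive zero    g = contradiction
        (≤-trans (*-mono-≤ 1≤A (*-mono-≤ (≤-trans 1≤h (≮⇒≥ U≮h)) (price-pos e Ve))) (≤-trans g (≤-reflexive (*-zeroʳ D)))) (λ ())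
      smaller : length (uncovered e U) ≤ fuel
      smaller = ≤-pred (≤-trans (+-monoˡ-≤ _ (positive _ gain)) (≤-trans (≤-reflexive (sym (length-uncovered e U))) U≤))
    ...   | S , U′ , VS , U′<h , PU′ , cover , paid =
      e ∷ S , U′ , Ve ∷ VS , U′<h , PU′ , cover′ , (begin
        A * (h * (price e + ∑ S price)) + D * length U′                 ≡⟨ ring A h (price e) (∑ S price) (D * length U′) ⟩
        A * (h * price e) + (A * (h * ∑ S price) + D * length U′)       ≤⟨ +-mono-≤ (≤-trans (*-monoʳ-≤ A (*-monoˡ-≤ (price e) (≮⇒≥ U≮h))) gain) paid ⟩
        D * ∑ U (ι e) + D * length (uncovered e U)                      ≡⟨ sym (*-distribˡ-+ D (∑ U (ι e)) _) ⟩
        D * (∑ U (ι e) + length (uncovered e U))                        ≡⟨ cong (D *_) (sym (length-uncovered e U)) ⟩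
        D * length U                                                    ∎)
      where
      ring : ∀ a h p c d → a * (h * (p + c)) + d ≡ a * (h * p) + (a * (h * c) + d)
      ring = solve-∀
      cover′ : ∀ q → q ∈ U → Covered (e ∷ S) q ⊎ q ∈ U′
      cover′ q q∈ with R? e q
      ... | yes Req = inj₁ (here Req)
      ... | no ¬Req = Sum.map₁ there (cover q (∈-filter⁺ (¬? ∘ R? e) q∈ ¬Req))

    -- A phase with threshold `2 ^ j` starts below `2 * 2 ^ j` uncovered elements and so costs at
    -- most `2 * D / A`. Counting halvings takes the place of the usual harmonic sum.
    greedy : ∀ j U → length U < 2 ^ j → All P U →
      ∃[ S ] All V S × (∀ q → q ∈ U → Covered S q) × A * ∑ S price ≤ 2 * D * j
    greedy zero    []      _        _  = [] , [] , (λ _ ()) , ≤-trans (≤-reflexive (*-zeroʳ A)) z≤n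
    greedy zero    (_ ∷ _) (s≤s ()) _
    greedy (suc j) U       U<       PU with phase (2 ^ j) (length U) U ≤-refl PU (m^n>0 2 j)
    ... | S , U′ , VS , U′< , PU′ , cover , paid with greedy j U′ U′< PU′
    ...   | S′ , VS′ , cover′ , paid′ = S ++ S′ , All.++⁺ VS VS′ , covered , (begin
      A * ∑ (S ++ S′) price               ≡⟨ trans (cong (A *_) (∑-++ S S′ price)) (*-distribˡ-+ A (∑ S price) (∑ S′ price)) ⟩
      A * ∑ S price + A * ∑ S′ price      ≤⟨ +-mono-≤ one paid′ ⟩
      2 * D + 2 * D * j                   ≡⟨ sym (*-suc (2 * D) j) ⟩
      2 * D * suc j                       ∎)
      where
      covered : ∀ q → q ∈ U → Covered (S ++ S′) q
      covered q q∈ with cover q q∈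
      ... | inj₁ h = Any.++⁺ˡ h
      ... | inj₂ h = Any.++⁺ʳ S (cover′ q h)
      ring₁ : ∀ h a c → h * (a * c) ≡ a * (h * c)
      ring₁ = solve-∀
      ring₂ : ∀ d h → d * (2 * h) ≡ h * (2 * d)
      ring₂ = solve-∀
      one : A * ∑ S price ≤ 2 * D
      one = *-cancelˡ-≤ (2 ^ j) {{>-nonZero (m^n>0 2 j)}} (begin
        2 ^ j * (A * ∑ S price)          ≡⟨ ring₁ (2 ^ j) A (∑ S price) ⟩
        A * (2 ^ j * ∑ S price)          ≤⟨ ≤-trans (m≤m+n _ (D * length U′)) paid ⟩
        D * length U                     ≤⟨ *-monoʳ-≤ D (<⇒≤ U<) ⟩
        D * (2 * 2 ^ j)                  ≡⟨ ring₂ D (2 ^ j) ⟩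
        2 ^ j * (2 * D)                  ∎)

-- Tables of balls from set cover

module Covering (k : ℕ) (1≤k : 1 ≤ k) (L : ℕ) where

  Entry : Set
  Entry = List Bool × ℕ

  entries : List Entry
  entries = cartesianProduct (words L) (upTo (suc L))

  Covers : Entry → List Bool → Set
  Covers (c , r) q = ham c q ≤ r × k * up c q ≤ weight q

  covers? : ∀ e q → Dec (Covers e q)
  covers? (c , r) q = (ham c q ≤? r) ×-dec light? k c q

  open SetCover {R = Covers} covers?

  length-entries : length entries ≡ 2 ^ L * suc L
  length-entries = trans (length-cartesianProduct (words L) (upTo (suc L)))
    (cong₂ _*_ (length-words L) (List.length-upTo (suc L)))

  entries-nonempty : 1 ≤ length entries
  entries-nonempty = ≤-trans (*-mono-≤ (m^n>0 2 L) (s≤s z≤n)) (≤-reflexive (sym length-entries))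

  -- `value` is the scaled likelihood of distance exactly `r`. For `r ≤ L` the product of price and
  -- value is always `k ^ L`.
  price value : Entry → ℕ
  price (c , r) = k ^ r
  value (c , r) = k ^ (L ∸ r)

  -- If `c` is light, the radius `ham c q` by itself contributes the full likelihood.
  lightLikelihood-≤ : ∀ q → length q ≡ L → ∀ c → c ∈ words L →
    lightLikelihood k q c ≤ ∑ (upTo (suc L)) (λ r → ι (c , r) q * value (c , r))
  lightLikelihood-≤ q |q| c c∈ with lightLikelihood-cases k q c
  ... | inj₂ eq = ≤-trans (≤-reflexive eq) z≤n
  ... | inj₁ (light , eq) = begin
    lightLikelihood k q c                       ≡⟨ eq ⟩
    likelihood k c q                            ≡⟨ likelihood-ham k c q (trans (∈-words⁻ L c∈) (sym |q|)) ⟩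
    k ^ (length q ∸ ham c q)                    ≡⟨ cong (λ l → k ^ (l ∸ ham c q)) |q| ⟩
    value (c , ham c q)                         ≡⟨ sym (+-identityʳ _) ⟩
    1 * value (c , ham c q)                     ≡⟨ cong (_* value (c , ham c q)) (sym (ι-yes {c , ham c q} {q} (≤-refl , light))) ⟩
    ι (c , ham c q) q * value (c , ham c q)     ≤⟨ ∑-∈ (λ r → ι (c , r) q * value (c , r)) (∈-upTo⁺ (s≤s (≤-trans (ham≤length c q) (≤-reflexive |q|)))) ⟩
    ∑ (upTo (suc L)) (λ r → ι (c , r) q * value (c , r)) ∎

  -- In other terms, the weights `(k + 1) * value e / (k + 1) ^ L` form a fractional cover of the
  -- cube; its total price is `D / A`.
  ∑-value : ∀ q → length q ≡ L → (k + 1) ^ L ≤ (k + 1) * ∑ entries (λ e → ι e q * value e)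
  ∑-value q |q| = begin
    (k + 1) ^ L                                       ≡⟨ cong ((k + 1) ^_) (sym |q|) ⟩
    (k + 1) ^ length q                                ≤⟨ ∑-lightLikelihood k q ⟩
    (k + 1) * ∑ (words (length q)) (lightLikelihood k q) ≡⟨ cong (λ l → (k + 1) * ∑ (words l) (lightLikelihood k q)) |q| ⟩
    (k + 1) * ∑ (words L) (lightLikelihood k q)       ≤⟨ *-monoʳ-≤ (k + 1) (∑-mono (words L) (lightLikelihood-≤ q |q|)) ⟩
    (k + 1) * ∑ (words L) (λ c → ∑ (upTo (suc L)) (λ r → ι (c , r) q * value (c , r)))
      ≡⟨ cong ((k + 1) *_) (sym (∑-cartesianProduct (words L) (upTo (suc L)) (λ e → ι e q * value e))) ⟩
    (k + 1) * ∑ entries (λ e → ι e q * value e)       ∎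

  A D : ℕ
  A = (k + 1) ^ L
  D = (k + 1) * (length entries * k ^ L)

  Sound : Entry → Set
  Sound (c , r) = length c ≡ L × r ≤ L

  -- Averaging over the fractional cover: an entry maximising value times gain reaches the mean, and
  -- multiplying by its price `k ^ r` turns the value into `k ^ L`.
  pick : ∀ U → All (λ q → length q ≡ L) U → ∃[ e ] Sound e × A * (length U * price e) ≤ D * ∑ U (ι e)
  pick U |U| with ∑-≤-length*max entries (λ e → value e * ∑ U (ι e)) entries-nonempty
  ... | (c , r) , e∈ , max = (c , r) , (∈-words⁻ L (proj₁ (∈-cartesianProduct⁻ (words L) (upTo (suc L)) e∈)) , r≤L) , (begin
    A * (length U * k ^ r)                           ≡⟨ ring₁ A (length U) (k ^ r) ⟩
    (length U * A) * k ^ r                           ≡⟨ cong (_* k ^ r) (sym (∑-const U A)) ⟩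
    ∑ U (λ _ → A) * k ^ r                            ≤⟨ *-monoˡ-≤ (k ^ r) (∑-mono U (λ q q∈ → ∑-value q (All.lookup |U| q∈))) ⟩
    ∑ U (λ q → (k + 1) * ∑ entries (λ e → ι e q * value e)) * k ^ r
      ≡⟨ cong (_* k ^ r) (trans (∑-* U (k + 1) _) (cong ((k + 1) *_) (∑-swap U entries (λ q e → ι e q * value e)))) ⟩
    (k + 1) * ∑ entries (λ e → ∑ U (λ q → ι e q * value e)) * k ^ r
      ≡⟨ cong (λ s → (k + 1) * s * k ^ r) (∑-cong entries (λ e → trans (∑-cong U (λ q → *-comm (ι e q) (value e))) (∑-* U (value e) (ι e)))) ⟩
    (k + 1) * ∑ entries (λ e → value e * ∑ U (ι e)) * k ^ r
      ≤⟨ *-monoˡ-≤ (k ^ r) (*-monoʳ-≤ (k + 1) max) ⟩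
    (k + 1) * (length entries * (k ^ (L ∸ r) * N)) * k ^ r
      ≡⟨ ring₂ (k + 1) (length entries) (k ^ (L ∸ r)) N (k ^ r) ⟩
    (k + 1) * (length entries * (k ^ (L ∸ r) * k ^ r)) * N
      ≡⟨ cong (λ p → (k + 1) * (length entries * p) * N) (trans (sym (^-distribˡ-+-* k (L ∸ r) r)) (cong (k ^_) (m∸n+n≡m r≤L))) ⟩
    D * N                                            ∎)
    where
    N : ℕ
    N = ∑ U (ι (c , r))
    r≤L : r ≤ L
    r≤L = ≤-pred (∈-upTo⁻ (proj₂ (∈-cartesianProduct⁻ (words L) (upTo (suc L)) e∈)))
    ring₁ : ∀ a u p → a * (u * p) ≡ (u * a) * p
    ring₁ = solve-∀
    ring₂ : ∀ a m v n p → a * (m * (v * n)) * p ≡ a * (m * (v * p)) * n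
    ring₂ = solve-∀

  A-pos : 1 ≤ A
  A-pos = ≤-trans (≤-reflexive (sym (^-zeroˡ L))) (^-monoˡ-≤ L (m≤n+m 1 k))

  price-pos : ∀ e → Sound e → 1 ≤ price e
  price-pos (c , r) _ = ≤-trans (≤-reflexive (sym (^-zeroˡ r))) (^-monoˡ-≤ r 1≤k)

  open Greedy {P = λ q → length q ≡ L} {V = Sound} price price-pos A D A-pos pick

  words<2^ : length (words L) < 2 ^ suc L
  words<2^ = ≤-trans (s≤s (≤-reflexive (length-words L))) (m<m+n (2 ^ L) (≤-trans (m^n>0 2 L) (m≤m+n _ 0)))

  covers⇒close : ∀ {S} q → length q ≡ L → All Sound S → Covered S q → Any (λ (c , a) → Close k a c q) S
  covers⇒close q |q| ((|c| , _) ∷ _) (here (h≤ , u≤)) = here (close (trans |c| (sym |q|)) h≤ u≤)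
  covers⇒close q |q| (_ ∷ sound)     (there h)        = there (covers⇒close q |q| sound h)

  table-exists : ∃[ S ] IsTable k L S × A * cost k S ≤ 2 * ((k + 1) * (2 ^ L * suc L * k ^ L)) * suc L
  table-exists = let (S , sound , cover , paid) = greedy (suc L) (words L) words<2^ (All.tabulate (∈-words⁻ L)) in
    S , record
      { sound  = sound
      ; covers = λ q |q| → covers⇒close q |q| sound (cover q (subst (λ l → q ∈ words l) |q| (∈-words⁺ q)))
      } , ≤-trans paid (≤-reflexive (cong (λ e → 2 * ((k + 1) * (e * k ^ L)) * suc L) length-entries))

-- The first three binomial terms, `(1 + 1/x)^m ≥ 1 + m/x + m(m-1)/(2x²)`, multiplied by `2 x² x^m`;
-- the term `x ^ m * m` is moved to the right to avoid subtraction.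
2x²+2mx+m²≤ : ∀ x m → x ^ m * (2 * (x * x) + 2 * (m * x) + m * m) ≤ 2 * (x * x) * (x + 1) ^ m + x ^ m * m
2x²+2mx+m²≤ x zero = ≤-reflexive (base x)
  where
  base : ∀ x → 1 * (2 * (x * x) + 2 * (0 * x) + 0 * 0) ≡ 2 * (x * x) * 1 + 1 * 0
  base = solve-∀
2x²+2mx+m²≤ x (suc m) = +-cancelʳ-≤ (p * m * x + p * m) _ _ (begin
  x * p * (2 * (x * x) + 2 * (suc m * x) + suc m * suc m) + (p * m * x + p * m)
    ≤⟨ +-monoʳ-≤ (x * p * (2 * (x * x) + 2 * (suc m * x) + suc m * suc m)) (+-monoʳ-≤ (p * m * x) (*-monoʳ-≤ p (m≤m² m))) ⟩
  x * p * (2 * (x * x) + 2 * (suc m * x) + suc m * suc m) + (p * m * x + p * (m * m))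
    ≡⟨ ring₁ x m p ⟩
  (x + 1) * (p * (2 * (x * x) + 2 * (m * x) + m * m)) + x * p * suc m
    ≤⟨ +-monoˡ-≤ (x * p * suc m) (*-monoʳ-≤ (x + 1) (2x²+2mx+m²≤ x m)) ⟩
  (x + 1) * (2 * (x * x) * (x + 1) ^ m + p * m) + x * p * suc m
    ≡⟨ ring₂ x m p ((x + 1) ^ m) ⟩
  2 * (x * x) * ((x + 1) * (x + 1) ^ m) + x * p * suc m + (p * m * x + p * m) ∎)
  where
  p : ℕ
  p = x ^ m
  m≤m² : ∀ m → m ≤ m * m
  m≤m² zero    = z≤n
  m≤m² (suc m) = m≤m+n (suc m) _
  ring₁ : ∀ x m p → x * p * (2 * (x * x) + 2 * (suc m * x) + suc m * suc m) + (p * m * x + p * (m * m))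
    ≡ (x + 1) * (p * (2 * (x * x) + 2 * (m * x) + m * m)) + x * p * suc m
  ring₁ = solve-∀
  ring₂ : ∀ x m p r → (x + 1) * (2 * (x * x) * r + p * m) + x * p * suc m
    ≡ 2 * (x * x) * ((x + 1) * r) + x * p * suc m + (p * m * x + p * m)
  ring₂ = solve-∀

-- Growth and time bounds

^-pos : ∀ {m} n → 1 ≤ m → 1 ≤ m ^ n
^-pos n 1≤m = ≤-trans (≤-reflexive (sym (^-zeroˡ n))) (^-monoˡ-≤ n 1≤m)

^-distribʳ-* : ∀ m n o → (m * n) ^ o ≡ m ^ o * n ^ o
^-distribʳ-* m n zero    = refl
^-distribʳ-* m n (suc o) = trans (cong (m * n *_) (^-distribʳ-* m n o)) (interchange m n (m ^ o) (n ^ o))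
  where
  interchange : ∀ a b c d → a * b * (c * d) ≡ a * c * (b * d)
  interchange = solve-∀

n<2^n : ∀ n → n < 2 ^ n
n<2^n zero    = s≤s z≤n
n<2^n (suc n) = ≤-trans (+-mono-≤ (m^n>0 2 n) (n<2^n n)) (≤-reflexive (cong (2 ^ n +_) (sym (+-identityʳ _))))

-- At `m = x = k` the three terms give `(1 + 1/k)^k ≥ 5/2 - 1/(2k)`, which is at least 7/3 for
-- `k ≥ 3`. The excess of 7/3 over 2, a factor 7/6, will absorb all polynomial factors in the block
-- length.
7k^k≤3[k+1]^k : ∀ k → 3 ≤ k → 7 * k ^ k ≤ 3 * (k + 1) ^ k
7k^k≤3[k+1]^k k 3≤k = *-cancelˡ-≤ (2 * (k * k)) {{>-nonZero (*-mono-≤ {1} {2} (s≤s z≤n) (*-mono-≤ 1≤k 1≤k))}}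
  (+-cancelʳ-≤ (p * (3 * k)) _ _ (begin
    2 * (k * k) * (7 * p) + p * (3 * k)                ≤⟨ +-monoʳ-≤ (2 * (k * k) * (7 * p)) (*-monoʳ-≤ p (*-monoˡ-≤ k 3≤k)) ⟩
    2 * (k * k) * (7 * p) + p * (k * k)                ≡⟨ ring₁ k p ⟩
    3 * (p * (2 * (k * k) + 2 * (k * k) + k * k))      ≤⟨ *-monoʳ-≤ 3 (2x²+2mx+m²≤ k k) ⟩
    3 * (2 * (k * k) * (k + 1) ^ k + p * k)            ≡⟨ ring₂ k p ((k + 1) ^ k) ⟩
    2 * (k * k) * (3 * (k + 1) ^ k) + p * (3 * k)      ∎))
  where
  p : ℕ
  p = k ^ k
  1≤k : 1 ≤ k
  1≤k = ≤-trans (s≤s z≤n) 3≤k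
  ring₁ : ∀ k p → 2 * (k * k) * (7 * p) + p * (k * k) ≡ 3 * (p * (2 * (k * k) + 2 * (k * k) + k * k))
  ring₁ = solve-∀
  ring₂ : ∀ k p r → 3 * (2 * (k * k) * r + p * k) ≡ 2 * (k * k) * (3 * r) + p * (3 * k)
  ring₂ = solve-∀

module _ (p q m : ℕ) (1≤m : 1 ≤ m) (2p^m≤q^m : 2 * p ^ m ≤ q ^ m) where

  2^s*p^≤q^ : ∀ s → 2 ^ s * p ^ (m * s) ≤ q ^ (m * s)
  2^s*p^≤q^ s = begin
    2 ^ s * p ^ (m * s)      ≡⟨ cong (2 ^ s *_) (sym (^-*-assoc p m s)) ⟩
    2 ^ s * (p ^ m) ^ s      ≡⟨ sym (^-distribʳ-* 2 (p ^ m) s) ⟩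
    (2 * p ^ m) ^ s          ≤⟨ ^-monoˡ-≤ s 2p^m≤q^m ⟩
    (q ^ m) ^ s              ≡⟨ ^-*-assoc q m s ⟩
    q ^ (m * s)              ∎

  -- With `l = m * (3 * u)` the ratio `q / p` yields `3 * u` doublings. Since `k * l = w * u`, the
  -- quadratic is at most `2 * (k + 1) * w² * (u + 1)²`, and `u` is chosen equal to that leading
  -- constant, which leaves `(u + 1)^3 ≤ 2^(3u)`.
  exponential-beats-quadratic : ∀ k → 1 ≤ k → ∃[ l ] 1 ≤ l × p ^ l * (2 * (k + 1) * ((k * l + 1) * (k * l + 1))) ≤ q ^ l
  exponential-beats-quadratic k 1≤k = m * (3 * u) , *-mono-≤ 1≤m (*-mono-≤ (s≤s (z≤n {2})) 1≤u) , (begin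
    p ^ (m * (3 * u)) * (2 * (k + 1) * (v * v))      ≤⟨ *-monoʳ-≤ (p ^ (m * (3 * u))) quadratic ⟩
    p ^ (m * (3 * u)) * 2 ^ (3 * u)                  ≡⟨ *-comm (p ^ (m * (3 * u))) (2 ^ (3 * u)) ⟩
    2 ^ (3 * u) * p ^ (m * (3 * u))                  ≤⟨ 2^s*p^≤q^ (3 * u) ⟩
    q ^ (m * (3 * u))                                ∎)
    where
    w u v : ℕ
    w = k * (m * 3)
    u = 2 * (k + 1) * (w * w)
    v = k * (m * (3 * u)) + 1
    1≤w : 1 ≤ w
    1≤w = *-mono-≤ 1≤k (*-mono-≤ 1≤m (s≤s (z≤n {2})))
    1≤u : 1 ≤ u
    1≤u = *-mono-≤ (*-mono-≤ (s≤s (z≤n {1})) (m≤n+m 1 k)) (*-mono-≤ 1≤w 1≤w)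
    regroup : ∀ k m u → k * (m * (3 * u)) ≡ k * (m * 3) * u
    regroup = solve-∀
    v≤ : v ≤ w * (u + 1)
    v≤ = begin
      k * (m * (3 * u)) + 1      ≡⟨ cong (_+ 1) (regroup k m u) ⟩
      w * u + 1                  ≤⟨ +-monoʳ-≤ (w * u) 1≤w ⟩
      w * u + w                  ≡⟨ cong (w * u +_) (sym (*-identityʳ w)) ⟩
      w * u + w * 1              ≡⟨ sym (*-distribˡ-+ w u 1) ⟩
      w * (u + 1)                ∎
    ring : ∀ a w s → a * (w * s * (w * s)) ≡ a * (w * w) * (s * s)
    ring = solve-∀
    quadratic : 2 * (k + 1) * (v * v) ≤ 2 ^ (3 * u)
    quadratic = begin
      2 * (k + 1) * (v * v)                              ≤⟨ *-monoʳ-≤ (2 * (k + 1)) (*-mono-≤ v≤ v≤) ⟩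
      2 * (k + 1) * (w * (u + 1) * (w * (u + 1)))        ≡⟨ ring (2 * (k + 1)) w (u + 1) ⟩
      u * ((u + 1) * (u + 1))                            ≤⟨ *-monoˡ-≤ _ (m≤m+n u 1) ⟩
      (u + 1) * ((u + 1) * (u + 1))                      ≡⟨ cong (λ s → (u + 1) * ((u + 1) * s)) (sym (*-identityʳ (u + 1))) ⟩
      (u + 1) ^ 3                                        ≤⟨ ^-monoˡ-≤ 3 (≤-trans (≤-reflexive (+-comm u 1)) (n<2^n u)) ⟩
      (2 ^ u) ^ 3                                        ≡⟨ ^-*-assoc 2 u 3 ⟩
      2 ^ (u * 3)                                        ≡⟨ cong (2 ^_) (*-comm u 3) ⟩
      2 ^ (3 * u)                                        ∎

2*6^6≤7^6 : 2 * 6 ^ 6 ≤ 7 ^ 6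
2*6^6≤7^6 = ≤ᵇ⇒≤ (2 * 6 ^ 6) (7 ^ 6) tt

-- The block length is `k * l`, so that the exponent `(1 - 1/k) * (k * l)` is the natural number
-- `k′ * l`.
CheapTable : ℕ → ℕ → Set
CheapTable k k′ = ∃[ l ] ∃[ l′ ] ∃[ table ] k * l ≡ suc l′ × IsTable k (suc l′) table × cost k table ≤ 2 ^ (k′ * l)

module _ (k k′ : ℕ) (k≡ : k ≡ suc k′) (3≤k : 3 ≤ k) where

  table-size : ∀ l → 6 ^ l * (2 * (k + 1) * ((k * l + 1) * (k * l + 1))) ≤ 7 ^ l →
    2 * ((k + 1) * (2 ^ (k * l) * suc (k * l) * k ^ (k * l))) * suc (k * l) ≤ (k + 1) ^ (k * l) * 2 ^ (k′ * l)
  table-size l h = begin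
    2 * ((k + 1) * (2 ^ (k * l) * suc (k * l) * k ^ (k * l))) * suc (k * l)
      -- `2 ^ (k * l)` splits into the target `2 ^ (k′ * l)` and a surplus `2 ^ l`, which
      -- `(1 + 1/k)^(k * l)` has to beat together with the polynomial `X`.
      ≡⟨ cong₂ (λ a b → 2 * ((k + 1) * (a * suc (k * l) * b)) * suc (k * l)) (trans (cong (λ k → 2 ^ (k * l)) k≡) (^-distribˡ-+-* 2 l (k′ * l))) (sym (^-*-assoc k k l)) ⟩
    2 * ((k + 1) * (2 ^ l * B * suc (k * l) * (k ^ k) ^ l)) * suc (k * l)
      ≡⟨ ring₁ (k + 1) (2 ^ l) B (k * l) ((k ^ k) ^ l) ⟩
    2 ^ l * (k ^ k) ^ l * X * B
      ≡⟨ cong (λ a → a * X * B) (sym (^-distribʳ-* 2 (k ^ k) l)) ⟩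
    (2 * k ^ k) ^ l * X * B
      ≤⟨ *-monoˡ-≤ B scaled ⟩
    ((k + 1) ^ k) ^ l * B
      ≡⟨ cong (_* B) (^-*-assoc (k + 1) k l) ⟩
    (k + 1) ^ (k * l) * B ∎
    where
    B X : ℕ
    B = 2 ^ (k′ * l)
    X = 2 * (k + 1) * ((k * l + 1) * (k * l + 1))
    ring₁ : ∀ k₁ t b m p → 2 * (k₁ * (t * b * suc m * p)) * suc m ≡ t * p * (2 * k₁ * ((m + 1) * (m + 1))) * b
    ring₁ = solve-∀
    ring₂ : ∀ p → 2 * p * 7 ≡ 2 * (7 * p)
    ring₂ = solve-∀
    ring₃ : ∀ p → 2 * (3 * p) ≡ 6 * p
    ring₃ = solve-∀
    ring₄ : ∀ s q x → s * (q * x) ≡ q * (s * x)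
    ring₄ = solve-∀
    scaled : (2 * k ^ k) ^ l * X ≤ ((k + 1) ^ k) ^ l
    scaled = *-cancelˡ-≤ (6 ^ l) {{>-nonZero (m^n>0 6 l)}} (begin
      6 ^ l * ((2 * k ^ k) ^ l * X)            ≡⟨ ring₄ (6 ^ l) ((2 * k ^ k) ^ l) X ⟩
      (2 * k ^ k) ^ l * (6 ^ l * X)            ≤⟨ *-monoʳ-≤ ((2 * k ^ k) ^ l) h ⟩
      (2 * k ^ k) ^ l * 7 ^ l                  ≡⟨ sym (^-distribʳ-* (2 * k ^ k) 7 l) ⟩
      (2 * k ^ k * 7) ^ l                      ≡⟨ cong (_^ l) (ring₂ (k ^ k)) ⟩
      (2 * (7 * k ^ k)) ^ l                    ≤⟨ ^-monoˡ-≤ l (*-monoʳ-≤ 2 (7k^k≤3[k+1]^k k 3≤k)) ⟩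
      (2 * (3 * (k + 1) ^ k)) ^ l              ≡⟨ cong (_^ l) (ring₃ ((k + 1) ^ k)) ⟩
      (6 * (k + 1) ^ k) ^ l                    ≡⟨ ^-distribʳ-* 6 ((k + 1) ^ k) l ⟩
      6 ^ l * ((k + 1) ^ k) ^ l                ∎)

  cheap-table-of-length : ∀ l l′ → k * l ≡ suc l′ →
    6 ^ l * (2 * (k + 1) * ((k * l + 1) * (k * l + 1))) ≤ 7 ^ l → CheapTable k k′
  cheap-table-of-length l l′ kl≡ h =
    let (table , isTable , paid) = Covering.table-exists k (≤-trans (s≤s z≤n) 3≤k) (k * l) in
    l , l′ , table , kl≡ , subst (λ L → IsTable k L table) kl≡ isTable ,
    *-cancelˡ-≤ ((k + 1) ^ (k * l)) {{>-nonZero (^-pos (k * l) (m≤n+m 1 k))}} (≤-trans paid (table-size l h))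

  cheap-table : CheapTable k k′
  cheap-table =
    let (l , 1≤l , h) = exponential-beats-quadratic 6 7 6 (s≤s z≤n) 2*6^6≤7^6 k 1≤k
    in cheap-table-of-length l (pred (k * l)) (sym (suc-pred (k * l) {{>-nonZero (*-mono-≤ 1≤k 1≤l)}})) h
    where
    1≤k : 1 ≤ k
    1≤k = ≤-trans (s≤s z≤n) 3≤k

-- The cost of filling undetermined bits

module Potential (k′ l l′ : ℕ) (kl : suc k′ * l ≡ suc l′) (table : Table)
  (cheap : cost (suc k′) table ≤ 2 ^ (k′ * l)) where

  -- Whole blocks count at the rate of the table, the remaining bits at the rate 2 of enumeration.
  Θ : ℕ → ℕ
  Θ m = 2 ^ (k′ * l * (m / suc l′)) * 2 ^ (m % suc l′)

  Θ-pos : ∀ m → 1 ≤ Θ m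
  Θ-pos m = *-mono-≤ (m^n>0 2 (k′ * l * (m / suc l′))) (m^n>0 2 (m % suc l′))

  Θ-small : ∀ m → m ≤ l′ → Θ m ≡ 2 ^ m
  Θ-small m m≤l′ = trans
    (cong₂ (λ a b → 2 ^ (k′ * l * a) * 2 ^ b) (m<n⇒m/n≡0 (s≤s m≤l′)) (m<n⇒m%n≡m (s≤s m≤l′)))
    (trans (cong (λ a → 2 ^ a * 2 ^ m) (*-zeroʳ (k′ * l))) (*-identityˡ (2 ^ m)))

  Θ-unit : ∀ m → m < l′ → 2 * Θ m ≤ Θ (suc m)
  Θ-unit m m<l′ = ≤-reflexive (trans (cong (2 *_) (Θ-small m (<⇒≤ m<l′))) (sym (Θ-small (suc m) m<l′)))

  Θ-table : ∀ m → cost (suc k′) table * Θ m ≤ Θ (suc l′ + m)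
  Θ-table m = begin
    cost (suc k′) table * Θ m                     ≤⟨ *-monoˡ-≤ (Θ m) cheap ⟩
    2 ^ a * (2 ^ (a * b) * 2 ^ c)                 ≡⟨ sym (*-assoc (2 ^ a) (2 ^ (a * b)) (2 ^ c)) ⟩
    2 ^ a * 2 ^ (a * b) * 2 ^ c                   ≡⟨ cong (_* 2 ^ c) (sym (^-distribˡ-+-* 2 a (a * b))) ⟩
    2 ^ (a + a * b) * 2 ^ c                       ≡⟨ cong (λ e → 2 ^ e * 2 ^ c) (sym (*-suc a b)) ⟩
    2 ^ (a * suc b) * 2 ^ c                       ≡⟨ cong₂ (λ d e → 2 ^ (a * d) * 2 ^ e) (sym quotient) (sym remainder) ⟩
    Θ (suc l′ + m)                                ∎
    where
    a b c : ℕ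
    a = k′ * l
    b = m / suc l′
    c = m % suc l′
    quotient : (suc l′ + m) / suc l′ ≡ suc b
    quotient = trans (+-distrib-/-∣ˡ m ∣-refl) (cong (_+ b) (n/n≡1 (suc l′)))
    remainder : (suc l′ + m) % suc l′ ≡ c
    remainder = trans (cong (_% suc l′) (+-comm (suc l′) m)) ([m+n]%n≡m%n m (suc l′))

  -- The remainder contributes at most the constant `2 ^ suc l′`. For the `q` whole blocks the
  -- exponent becomes `k′ * (q * suc l′)`, and `q * suc l′ ≤ n`.
  Θ-bound : ∀ n → Θ n ^ suc k′ ≤ (2 ^ suc l′) ^ suc k′ * 2 ^ (k′ * n)
  Θ-bound n = begin
    (2 ^ (k′ * l * q) * 2 ^ r) ^ k              ≡⟨ ^-distribʳ-* (2 ^ (k′ * l * q)) (2 ^ r) k ⟩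
    (2 ^ (k′ * l * q)) ^ k * (2 ^ r) ^ k        ≤⟨ *-mono-≤ exponent (^-monoˡ-≤ k (^-monoʳ-≤ 2 (<⇒≤ (m%n<n n (suc l′))))) ⟩
    2 ^ (k′ * n) * (2 ^ suc l′) ^ k             ≡⟨ *-comm (2 ^ (k′ * n)) _ ⟩
    (2 ^ suc l′) ^ k * 2 ^ (k′ * n)             ∎
    where
    k q r : ℕ
    k = suc k′
    q = n / suc l′
    r = n % suc l′
    ring : ∀ k′ l q k → k′ * l * q * k ≡ k′ * (q * (k * l))
    ring = solve-∀
    exponent : (2 ^ (k′ * l * q)) ^ k ≤ 2 ^ (k′ * n)
    exponent = begin
      (2 ^ (k′ * l * q)) ^ k      ≡⟨ ^-*-assoc 2 (k′ * l * q) k ⟩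
      2 ^ (k′ * l * q * k)        ≡⟨ cong (2 ^_) (trans (ring k′ l q k) (cong (λ L → k′ * (q * L)) kl)) ⟩
      2 ^ (k′ * (q * suc l′))     ≤⟨ ^-monoʳ-≤ 2 (*-monoʳ-≤ k′ (m/n*n≤m n (suc l′))) ⟩
      2 ^ (k′ * n)                ∎

-- Polynomial bounds

Polynomial : (ℕ → ℕ) → Set
Polynomial f = ∃[ C ] ∃[ d ] (∀ n → f n ≤ C * (n + 1) ^ d)

poly-const : ∀ c → Polynomial (λ _ → c)
poly-const c = c , 0 , λ n → ≤-reflexive (sym (*-identityʳ c))

poly-id : Polynomial (λ n → n)
poly-id = 1 , 1 , λ n → ≤-trans (m≤m+n n 1) (≤-reflexive (trans (sym (*-identityʳ (n + 1))) (sym (+-identityʳ _))))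

poly-+ : ∀ {f g} → Polynomial f → Polynomial g → Polynomial (λ n → f n + g n)
poly-+ {f} {g} (C , d , hf) (D , e , hg) = C + D , d + e , λ n → begin
  f n + g n                                            ≤⟨ +-mono-≤ (hf n) (hg n) ⟩
  C * (n + 1) ^ d + D * (n + 1) ^ e                    ≤⟨ +-mono-≤ (*-monoʳ-≤ C (grow n (m≤m+n d e))) (*-monoʳ-≤ D (grow n (m≤n+m e d))) ⟩
  C * (n + 1) ^ (d + e) + D * (n + 1) ^ (d + e)        ≡⟨ sym (*-distribʳ-+ ((n + 1) ^ (d + e)) C D) ⟩
  (C + D) * (n + 1) ^ (d + e)                          ∎
  where
  grow : ∀ n {a b} → a ≤ b → (n + 1) ^ a ≤ (n + 1) ^ b
  grow n = ^-monoʳ-≤ (n + 1) {{>-nonZero (m≤n+m 1 n)}}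

poly-* : ∀ {f g} → Polynomial f → Polynomial g → Polynomial (λ n → f n * g n)
poly-* {f} {g} (C , d , hf) (D , e , hg) = C * D , d + e , λ n → begin
  f n * g n                                    ≤⟨ *-mono-≤ (hf n) (hg n) ⟩
  C * (n + 1) ^ d * (D * (n + 1) ^ e)          ≡⟨ interchange C ((n + 1) ^ d) D ((n + 1) ^ e) ⟩
  C * D * ((n + 1) ^ d * (n + 1) ^ e)          ≡⟨ cong (C * D *_) (sym (^-distribˡ-+-* (n + 1) d e)) ⟩
  C * D * (n + 1) ^ (d + e)                    ∎
  where
  interchange : ∀ a b c d → a * b * (c * d) ≡ a * c * (b * d)
  interchange = solve-∀

poly-^ : ∀ c → Polynomial (_^ c)
poly-^ c = 1 , c , λ n → ≤-trans (^-monoˡ-≤ c (m≤m+n n 1)) (≤-reflexive (sym (+-identityʳ _)))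

poly-fold-time : ∀ {f g} → Polynomial f → Polynomial g → Polynomial (λ n → fold-time (f n) (g n))
poly-fold-time pf pg = poly-+ (poly-* pf (poly-+ (poly-const 5) pg)) (poly-const 2)

poly-bound : ∀ {f} → Polynomial f → ∃[ d ] (∀ n → f n ≤ n ^ d + d)
poly-bound {f} (C , d , h) = D , bound
  where
  K D : ℕ
  K = C * 2 ^ d
  -- Beyond `K` one more power of `n` outweighs the constant `C * 2 ^ d`; up to `K` the summand
  -- `C * (K + 1) ^ d` bounds `f` outright.
  D = suc d + C * (K + 1) ^ d
  bound : ∀ n → f n ≤ n ^ D + D
  bound n with n ≤? K
  ... | yes n≤K = begin
    f n                     ≤⟨ h n ⟩
    C * (n + 1) ^ d         ≤⟨ *-monoʳ-≤ C (^-monoˡ-≤ d (+-monoˡ-≤ 1 n≤K)) ⟩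
    C * (K + 1) ^ d         ≤⟨ m≤n+m _ (suc d) ⟩
    D                       ≤⟨ m≤n+m D (n ^ D) ⟩
    n ^ D + D               ∎
  ... | no n≰K = begin
    f n                     ≤⟨ h n ⟩
    C * (n + 1) ^ d         ≤⟨ *-monoʳ-≤ C (^-monoˡ-≤ d (≤-trans (+-monoʳ-≤ n 1≤n) (≤-reflexive (cong (n +_) (sym (+-identityʳ n)))))) ⟩
    C * (2 * n) ^ d         ≡⟨ trans (cong (C *_) (^-distribʳ-* 2 n d)) (sym (*-assoc C (2 ^ d) (n ^ d))) ⟩
    K * n ^ d               ≤⟨ *-monoˡ-≤ (n ^ d) (<⇒≤ (≰⇒> n≰K)) ⟩
    n ^ suc d               ≤⟨ ^-monoʳ-≤ n {{>-nonZero 1≤n}} (m≤m+n (suc d) _) ⟩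
    n ^ D                   ≤⟨ m≤m+n (n ^ D) D ⟩
    n ^ D + D               ∎
    where
    1≤n : 1 ≤ n
    1≤n = ≤-trans (s≤s z≤n) (≰⇒> n≰K)

IsO*-intro : ∀ k (T b Θ : ℕ → ℕ) C → Polynomial (λ n → b n * C) → (∀ n → T n ≤ b n * Θ n) →
  (∀ n → Θ n ^ k ≤ C ^ k * 2 ^ ((k ∸ 1) * n)) → IsO*2^[1-1/ k ]n T
IsO*-intro k T b Θ C poly T≤ Θ≤ = let (d , bound) = poly-bound poly in d , λ n → begin
  T n ^ k                                        ≤⟨ ^-monoˡ-≤ k (T≤ n) ⟩
  (b n * Θ n) ^ k                                ≡⟨ ^-distribʳ-* (b n) (Θ n) k ⟩
  b n ^ k * Θ n ^ k                              ≤⟨ *-monoʳ-≤ (b n ^ k) (Θ≤ n) ⟩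
  b n ^ k * (C ^ k * 2 ^ ((k ∸ 1) * n))          ≡⟨ sym (*-assoc (b n ^ k) (C ^ k) (2 ^ ((k ∸ 1) * n))) ⟩
  b n ^ k * C ^ k * 2 ^ ((k ∸ 1) * n)            ≡⟨ cong (_* 2 ^ ((k ∸ 1) * n)) (sym (^-distribʳ-* (b n) C k)) ⟩
  (b n * C) ^ k * 2 ^ ((k ∸ 1) * n)              ≤⟨ *-monoˡ-≤ (2 ^ ((k ∸ 1) * n)) (^-monoˡ-≤ k (bound n)) ⟩
  (n ^ d + d) ^ k * 2 ^ ((k ∸ 1) * n)            ∎

-- The program, its correctness and its running time

module Algorithm (k : ℕ) .{{_ : NonZero k}} (1≤k : 1 ≤ k) (l′ : ℕ) (table : Table) (isTable : IsTable k (suc l′) table)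
  (Θ : ℕ → ℕ) (Θ-pos : ∀ m → 1 ≤ Θ m) (Θ-unit : ∀ m → m < l′ → 2 * Θ m ≤ Θ (suc m))
  (Θ-table : ∀ m → cost k table * Θ m ≤ Θ (suc l′ + m))
  (C : ℕ) (Θ-bound : ∀ n → Θ n ^ k ≤ C ^ k * 2 ^ ((k ∸ 1) * n)) where

  open Search k 1≤k l′ table isTable Θ Θ-pos Θ-unit Θ-table

  search-code : Code
  search-code =
    ret (cons (hd x) (cons nil (cons (cons (tl x) (cons nil nil)) nil))) ++
    loop (tl (tl x)) body-code ++
    ret (hd (tl x))

  -- One search is used twice. From the reference `[]`, read as all-false, it finds a solution `y₁`
  -- if there is any; from the reference `y₁` it finds a heavy offset, which `xorWith-code` turns
  -- back into an assignment.
  main-code : Code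
  main-code =
    call (cons (cons (tl x) nil) (hd x)) search-code ++
    call (cons (cons (tl (hd x)) (tl x)) (hd (hd x))) search-code ++
    call (cons (tl (hd x)) (tl x)) xorWith-code ++
    ret (cons (tl (hd (hd x))) (tl x))

  module _ {n : ℕ} (F : CNF n) (kF : IsKCNF k F) where

    search-time : ℕ
    search-time = 1 + (((2 * n + 1) * Θ n * suc (step-time [] F kF) + 1) + 1)

    main-time : ℕ
    main-time = (4 + search-time) + ((4 + search-time) + ((4 + xorWith-time n) + 1))

    search-↦ : ∀ r → ∃[ y ]
      search-code ⊢ (encodeList (encodeList encodeLiteral) F ∙ bits r) ∙ encodeℕ n ↦ bits y ⟨ search-time ⟩ ×
      -- This holds for unsatisfiable `F` too, where `y` stays `[]`, and bounds the time of
      -- `xorWith-code` in every case.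
      length y ≤ n × (∀ z → length z ≡ n → Sol r F z → Good r F z y)
    search-↦ r with loop-↦ r F kF ((2 * n + 1) * Θ n) [] ((n , 0 , []) ∷ [])
        (≤-reflexive (initial n (Θ n)))
        (inv (+-identityʳ n ∷ []) (inj₁ refl)
          (λ z |z| _ → inj₂ (here (z , [] , sym (List.++-identityʳ z) , |z| , close refl z≤n (≤-reflexive (*-zeroʳ k))))))
      where
      initial : ∀ n t → (2 * n + 0 + 1) * (1 * t) + 0 ≡ (2 * n + 1) * t
      initial = solve-∀
    ... | y , i , run = y , seq (ret-↦ (λ S → refl)) (seq run (ret-↦ (λ S → refl))) ,
      best-length r F (Invariant.best-ok i) , good
      where
      good : ∀ z → length z ≡ n → Sol r F z → Good r F z y
      good z |z| sol with Invariant.hit i z |z| sol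
      ... | inj₁ g = g

    main-↦ : ∃[ t ] main-code ⊢ encode F ↦ t ⟨ main-time ⟩ ×
      (Satisfiable F → let (z₁ , z₂) = decodePair n t in z₁ ⊨ F × z₂ ⊨ F × (k ∸ 1) * Diam F ≤ 2 * k * d-H z₁ z₂)
    main-↦ with search-↦ []
    ... | y₁ , run₁ , _ , good₁ with search-↦ y₁
    ...   | y₂ , run₂ , y₂≤n , good₂ =
      bits y₁ ∙ bits (xorWith y₁ y₂) ,
      seq (call-↦ (λ S → refl) run₁) (seq (call-↦ (λ S → refl) run₂)
        (seq (call-↦ (λ S → refl) (xorWith-↦ y₁ y₂ y₂≤n)) (ret-↦ (λ S → refl)))) ,
      correct
      where
      z₁ z₂ : Assignment n
      z₁ = decode n (bits y₁)
      z₂ = decode n (bits (xorWith y₁ y₂))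
      correct : Satisfiable F → z₁ ⊨ F × z₂ ⊨ F × (k ∸ 1) * Diam F ≤ 2 * k * d-H z₁ z₂
      correct (w , w⊨F) = z₁⊨F , z₂⊨F , Diam-all (λ d → (k ∸ 1) * d ≤ 2 * k * d-H z₁ z₂)
          (≤-trans (≤-reflexive (*-zeroʳ (k ∸ 1))) z≤n) pair
        where
        g₁ : Good [] F (toList w) y₁
        g₁ = good₁ (toList w) (Vec.length-toList w) (⊨⇒Sol [] (toList w) w (bit-toList w) w⊨F)
        z₁⊨F : z₁ ⊨ F
        z₁⊨F = Sol⇒⊨ [] y₁ z₁ (λ i → sym (lookup-decode n y₁ i)) (proj₁ g₁)
        g₂ : ∀ v → v ⊨ F → Good y₁ F (offset y₁ v) y₂
        g₂ v v⊨F = good₂ (offset y₁ v) (Vec.length-toList (zipWith _xor_ z₁ v)) (⊨⇒Sol y₁ (offset y₁ v) v (bit-offset y₁ v) v⊨F)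
        |y₂| : length y₂ ≡ n
        |y₂| = proj₁ (proj₂ (g₂ w w⊨F))
        z₂⊨F : z₂ ⊨ F
        z₂⊨F = Sol⇒⊨ y₁ y₂ z₂
          (λ i → trans (sym (bit-xorWith y₁ y₂ (toℕ i) (subst (toℕ i <_) (sym |y₂|) (toℕ<n i))))
                       (sym (lookup-decode n (xorWith y₁ y₂) i)))
          (proj₁ (g₂ w w⊨F))
        weight-y₂ : weight y₂ ≡ d-H z₁ z₂
        weight-y₂ = trans (sym (d-H-decode-xorWith y₁ y₂))
          (cong (λ m → d-H (decode m (bits y₁)) (decode m (bits (xorWith y₁ y₂)))) |y₂|)
        radius : ∀ v → v ⊨ F → (k ∸ 1) * d-H z₁ v ≤ k * d-H z₁ z₂
        radius v v⊨F = begin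
          (k ∸ 1) * d-H z₁ v                       ≡⟨ *-distribʳ-∸ (d-H z₁ v) k 1 ⟩
          k * d-H z₁ v ∸ 1 * d-H z₁ v              ≡⟨ cong (k * d-H z₁ v ∸_) (*-identityˡ (d-H z₁ v)) ⟩
          k * d-H z₁ v ∸ d-H z₁ v                  ≤⟨ m≤n+o⇒m∸n≤o (k * d-H z₁ v) (d-H z₁ v) (≤-trans bound (≤-reflexive (+-comm (k * d-H z₁ z₂) _))) ⟩
          k * d-H z₁ z₂                            ∎
          where
          bound : k * d-H z₁ v ≤ k * d-H z₁ z₂ + d-H z₁ v
          bound = subst₂ (λ a b → k * a ≤ k * b + a) (weight-toList z₁ v) weight-y₂ (proj₂ (proj₂ (g₂ v v⊨F)))
        pair : ∀ u v → u ⊨ F → v ⊨ F → (k ∸ 1) * d-H u v ≤ 2 * k * d-H z₁ z₂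
        pair u v u⊨F v⊨F = begin
          (k ∸ 1) * d-H u v                           ≤⟨ *-monoʳ-≤ (k ∸ 1) (d-H-triangle u z₁ v) ⟩
          (k ∸ 1) * (d-H z₁ u + d-H z₁ v)             ≡⟨ *-distribˡ-+ (k ∸ 1) (d-H z₁ u) (d-H z₁ v) ⟩
          (k ∸ 1) * d-H z₁ u + (k ∸ 1) * d-H z₁ v     ≤⟨ +-mono-≤ (radius u u⊨F) (radius v v⊨F) ⟩
          k * d-H z₁ z₂ + k * d-H z₁ z₂               ≡⟨ double k (d-H z₁ z₂) ⟩
          2 * k * d-H z₁ z₂                           ∎
          where
          double : ∀ k d → k * d + k * d ≡ 2 * k * d
          double = solve-∀

  program : Program
  program = 1 , main-code

  step-bound : ℕ → ℕ → ℕ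
  step-bound m n = 3 + ((4 + find-time k m n) + inspect-time n)

  search-bound : ℕ → ℕ → ℕ → ℕ
  search-bound m n θ = 1 + (((2 * n + 1) * θ * suc (step-bound m n) + 1) + 1)

  time-bound : ℕ → ℕ → ℕ → ℕ
  time-bound m n θ = (4 + search-bound m n θ) + ((4 + search-bound m n θ) + ((4 + xorWith-time n) + 1))

  -- `time-bound` is affine in `θ` with constant term `19 + xorWith-time n`, so for `θ ≥ 1` the
  -- factor can be taken out of the whole.
  time-bound-≤ : ∀ m n θ → 1 ≤ θ → time-bound m n θ ≤ time-bound m n 1 * θ
  time-bound-≤ m n (suc θ) _ = ≤-trans (m≤m+n _ (θ * (19 + xorWith-time n)))
    (≤-reflexive (ring (2 * n + 1) (suc (step-bound m n)) (xorWith-time n) θ))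
    where
    ring : ∀ a b w θ →
      (4 + (1 + ((a * suc θ * b + 1) + 1))) + ((4 + (1 + ((a * suc θ * b + 1) + 1))) + ((4 + w) + 1)) + θ * (19 + w)
      ≡ ((4 + (1 + ((a * 1 * b + 1) + 1))) + ((4 + (1 + ((a * 1 * b + 1) + 1))) + ((4 + w) + 1))) * suc θ
    ring = solve-∀

  module _ (c : ℕ) where

    clauses : ℕ → ℕ
    clauses n = n ^ c + c

    -- The exponent `c` of the clause count enters only here, in the time bound; the program is the
    -- same for all `c`.
    T : ℕ → ℕ
    T n = time-bound (clauses n) n (Θ n)

    poly-bit-time : Polynomial bit-time
    poly-bit-time = poly-+ (poly-fold-time poly-id (poly-const 1)) (poly-const 1)

    poly-falsifies-time : Polynomial falsifies-time
    poly-falsifies-time = poly-+ lookup-time (poly-+ lookup-time (poly-const 11))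
      where
      lookup-time : Polynomial (λ n → 4 + bit-time n)
      lookup-time = poly-+ (poly-const 4) poly-bit-time

    poly-clauses : Polynomial clauses
    poly-clauses = poly-+ (poly-^ c) (poly-const c)

    poly-clause-time : Polynomial (clause-time k)
    poly-clause-time = poly-fold-time (poly-const k) (poly-+ (poly-+ (poly-const 5) poly-falsifies-time) (poly-const 1))

    poly-find-time : Polynomial (λ n → find-time k (clauses n) n)
    poly-find-time = poly-fold-time poly-clauses (poly-+ (poly-+ (poly-const 5) poly-clause-time) (poly-const 2))

    poly-reverse-time : Polynomial (λ n → fold-time n 1)
    poly-reverse-time = poly-fold-time poly-id (poly-const 1)

    poly-flip-time : Polynomial flip-time
    poly-flip-time = poly-+ (poly-const 1) (poly-+ poly-reverse-time (poly-+ (poly-const 2) poly-reverse-time))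

    poly-weight-time : Polynomial weight-time
    poly-weight-time = poly-+ (poly-const 1) (poly-fold-time poly-id (poly-const 2))

    poly-heavier-time : Polynomial heavier-time
    poly-heavier-time = poly-+ w (poly-+ w (poly-+ (poly-+ (poly-const 4) poly-reverse-time) (poly-const 2)))
      where
      w : Polynomial (λ n → 4 + weight-time n)
      w = poly-+ (poly-const 4) poly-weight-time

    poly-children-time : Polynomial (children-time k)
    poly-children-time = poly-fold-time (poly-const k) (poly-+ (poly-+ (poly-const 4) poly-flip-time) (poly-const 1))

    poly-inspect-time : Polynomial inspect-time
    poly-inspect-time = poly-+
      (poly-+ (poly-const 2) (poly-+ (poly-+ (poly-const 4) poly-children-time) (poly-const 1)))
      (poly-+ (poly-const 1) (poly-+ (poly-+ (poly-const 4) poly-heavier-time) (poly-const 1)))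

    poly-xorWith-time : Polynomial xorWith-time
    poly-xorWith-time = poly-+ (poly-const 1) (poly-+ (poly-fold-time poly-id (poly-const 8)) (poly-+ (poly-const 1) poly-reverse-time))

    poly-search : Polynomial (λ n → 4 + search-bound (clauses n) n 1)
    poly-search = poly-+ (poly-const 5)
      (poly-+ (poly-+ (poly-* (poly-* (poly-+ (poly-* (poly-const 2) poly-id) (poly-const 1)) (poly-const 1))
        (poly-+ (poly-const 4) (poly-+ (poly-+ (poly-const 4) poly-find-time) poly-inspect-time))) (poly-const 1)) (poly-const 1))

    poly-time : Polynomial (λ n → time-bound (clauses n) n 1 * C)
    poly-time = poly-* (poly-+ poly-search (poly-+ poly-search (poly-+ (poly-+ (poly-const 4) poly-xorWith-time) (poly-const 1))))
      (poly-const C)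

    T-IsO* : IsO*2^[1-1/ k ]n T
    T-IsO* = IsO*-intro k T (λ n → time-bound (clauses n) n 1) Θ C poly-time
      (λ n → time-bound-≤ (clauses n) n (Θ n) (Θ-pos n)) Θ-bound

    module _ {n : ℕ} (F : CNF n) (kF : IsKCNF k F) (F≤ : length F ≤ clauses n) where

      main-time≤T : main-time F kF ≤ T n
      main-time≤T = +-mono-≤ 4+search (+-monoˡ-≤ ((4 + xorWith-time n) + 1) 4+search)
        where
        4+search : 4 + search-time F kF ≤ 4 + search-bound (clauses n) n (Θ n)
        4+search = +-monoʳ-≤ 5 (+-monoˡ-≤ 1 (+-monoˡ-≤ 1 (*-monoʳ-≤ ((2 * n + 1) * Θ n)
          (s≤s (+-monoʳ-≤ 3 (+-monoˡ-≤ (inspect-time n) (+-monoʳ-≤ 4 (fold-time-mono _ F≤))))))))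

      outcome : HaltsWithin program (encode F) (T n) × (Satisfiable F → successProbability k program F (T n) ≡ 1ℚ)
      outcome = halts×succeeds k main-code (main-time F kF) (T n) F main-time≤T (main-↦ F kF)

  result : ∃[ P ] ((c : ℕ) → ∃[ T ]
      ( IsO*2^[1-1/ k ]n T
      × (∀ n (F : CNF n) → IsKCNF k F → length F ≤ n ^ c + c →
      HaltsWithin P (encode F) (T n))
      × ((ε : ℚ) → 0ℚ <ℚ ε → ∃[ N ] (∀ n → N ≤ n →
      (F : CNF n) → IsKCNF k F → length F ≤ n ^ c + c → Satisfiable F →
      1ℚ -ℚ ε ≤ℚ successProbability k P F (T n)))))
  result = program , λ c →
      T c
    , T-IsO* c
    , (λ n F kF F≤ → proj₁ (outcome c F kF F≤))
    , λ ε 0<ε → 0 , λ n _ F kF F≤ sat →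
        ℚ.≤-trans (1-ε≤1 ε 0<ε) (ℚ.≤-reflexive (sym (proj₂ (outcome c F kF F≤) sat)))

theorem4 : (k : ℕ) .{{_ : NonZero k}} → 3 ≤ k →
    ∃[ P ] ((c : ℕ) → ∃[ T ]
    ( IsO*2^[1-1/ k ]n T
    × (∀ n (F : CNF n) → IsKCNF k F → length F ≤ n ^ c + c →
    HaltsWithin P (encode F) (T n))
    × ((ε : ℚ) → 0ℚ <ℚ ε → ∃[ N ] (∀ n → N ≤ n →
    (F : CNF n) → IsKCNF k F → length F ≤ n ^ c + c → Satisfiable F →
    1ℚ -ℚ ε ≤ℚ successProbability k P F (T n)))))
theorem4 (suc k′) 3≤k = from (cheap-table (suc k′) k′ refl 3≤k)
  where
  from : CheapTable (suc k′) k′ → _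
  from (l , l′ , table , kl≡ , isTable , cheap) =
    Algorithm.result (suc k′) (s≤s z≤n) l′ table isTable Θ Θ-pos Θ-unit Θ-table (2 ^ suc l′) Θ-bound
    where open Potential k′ l l′ kl≡ table cheap
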